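{- For every $n \in \mathbb{N}$, $$ d^B_n(x) \;=\; \sum \binom{n}{r_0, r_1, \dots, r_k}\, x^{\lfloor (k+1)/2 \rfloor}\, d_{r_0}(x)\, A_{r_1}(x) \cdots A_{r_k}(x), $$ where the sum ranges over all $k \in \mathbb{N}$ and all sequences $(r_0, r_1, \dots, r_k)$ of nonnegative integers with $r_0 + \cdots + r_k = n$, and where the conventions $A_0(x) = 0$ and $d_0(x) = 1$ are used.
   Context: Type A: for a permutation $u$ of $[m]=\{1,\dots,m\}$, $\mathrm{exc}(u) = \#\{i : u(i) > i\}$ and $\mathrm{des}(u) = \#\{i \in [m-1] : u(i) > u(i+1)\}$. For $m \ge 1$, $A_m(x) = \sum_{u \in \mathfrak{S}_m} x^{\mathrm{des}(u)}$ is the Eulerian polynomial and $d_m(x) = \sum_{u} x^{\mathrm{exc}(u)}$ is the derangement polynomial, where the sum runs over permutations $u \in \mathfrak{S}_m$ without fixed points. Signed permutations: a signed permutation of $[n]$ is a pair consisting of a set $S = \{a_1, \dots, a_n\}$ with $a_i \in \{i, -i\}$ for each $i$, and a bijection $w : S \to S$. The set of all of them is $B_n$. - An element $a \in S$ is a $B$-excedance of $w$ if either $w(a) > a$, or $a < 0$ and $w(a) = a$ (all comparisons are in $\mathbb{Z}$). - $\mathrm{exc}_B(w)$ denotes the number of $B$-excedances of $w$. - $w$ is a derangement if there is no $a \in S$ with $a > 0$ and $w(a) = a$; the set of derangements is $\mathcal{D}^B_n$. - $d^B_n(x) = \sum_{w \in \mathcal{D}^B_n} x^{\mathrm{exc}_B(w)}$,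 with $d^B_0(x) = 1$. -}

module Defs where

open import Data.Fin.Base as Fin using (Fin; zero; suc; toℕ; inject₁)
import Data.Fin.Properties as Fin
open import Data.Integer.Base as ℤ using (ℤ; 0ℤ; _◃_)
import Data.Integer.Properties as ℤ
open import Data.List.Base as List
  using (List; []; _∷_; map; foldr; filter; cartesianProduct; cartesianProductWith;
         replicate; upTo; allFin)
open import Data.Nat.Base using (ℕ; zero; suc; _+_; _*_; _/_; _!; _≤_; NonZero; ⌊_/2⌋)
open import Data.Nat.Properties using (_≟_; _!≢0; m*n≢0)
open import Data.Product.Base using (_×_; _,_; ∃-syntax)
open import Data.Sign.Base as Sign using (Sign)
open import Data.Sum.Base using (_⊎_)
open import Data.Vec.Base as Vec using (Vec; []; _∷_; lookup; count)
open import Function.Base using (_∘_)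
open import Function.Consequences.Propositional
  using (strictlySurjective⇒surjective; surjective⇒strictlySurjective)
open import Function.Definitions using (Injective; Bijective; StrictlySurjective)
open import Relation.Binary.PropositionalEquality.Core using (_≡_; refl)
open import Relation.Nullary.Decidable using (Dec; map′; ¬?; _×-dec_; _⊎-dec_; _→-dec_)
open import Relation.Nullary.Negation.Core using (¬_)
open import Relation.Unary using (Decidable)

infix  4 _≈_
infixl 6 _⊕_
infixl 7 _⊗_ _·_

-- Polynomials in one variable x over ℕ, as coefficient lists with the constant
-- term first.  Trailing zeros are allowed, so the equality of polynomials is _≈_
-- and not propositional equality of lists.

ℕ[x] : Set
ℕ[x] = List ℕ

coeff : ℕ[x] → ℕ → ℕ
coeff []      _       = 0
coeff (a ∷ p) zero    = a
coeff (a ∷ p) (suc j) = coeff p j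

_≈_ : ℕ[x] → ℕ[x] → Set
p ≈ q = ∀ j → coeff p j ≡ coeff q j

0ₚ 1ₚ : ℕ[x]
0ₚ = []
1ₚ = 1 ∷ []

x^ : ℕ → ℕ[x]
x^ j = replicate j 0 List.++ 1ₚ

_⊕_ : ℕ[x] → ℕ[x] → ℕ[x]
[]      ⊕ q       = q
(a ∷ p) ⊕ []      = a ∷ p
(a ∷ p) ⊕ (b ∷ q) = (a + b) ∷ (p ⊕ q)

_·_ : ℕ → ℕ[x] → ℕ[x]
c · p = map (c *_) p

_⊗_ : ℕ[x] → ℕ[x] → ℕ[x]
[]      ⊗ q = 0ₚ
(a ∷ p) ⊗ q = a · q ⊕ (0 ∷ p ⊗ q)

∑ : {I : Set} → List I → (I → ℕ[x]) → ℕ[x]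
∑ is f = foldr _⊕_ 0ₚ (map f is)

∏ : ∀ {k} → Vec ℕ[x] k → ℕ[x]
∏ = Vec.foldr _ _⊗_ 1ₚ

-- The sum of a family indexed by all of ℕ makes sense algebraically when only
-- finitely many of its terms are nonzero; this is part of the predicate.

HasSum : (ℕ → ℕ[x]) → ℕ[x] → Set
HasSum f p = ∃[ N ] (∀ k → N ≤ k → f k ≈ 0ₚ) × ∑ (upTo N) f ≈ p

-- All vectors of length k with entries taken from the given list.

vectors : {I : Set} → List I → (k : ℕ) → List (Vec I k)
vectors is zero    = [] ∷ []
vectors is (suc k) = cartesianProductWith _∷_ is (vectors is k)

-- Permutations of [m] in one-line notation; Fin m stands for [m], with the letter
-- i ∈ [m] shifted down to i - 1.

IsPermutation : ∀ {m} → Vec (Fin m) m → Set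
IsPermutation u = Bijective _≡_ _≡_ (lookup u)

isPermutation? : ∀ {m} → Decidable (IsPermutation {m})
isPermutation? u = injective? ×-dec surjective?
  where
  injective? : Dec (Injective _≡_ _≡_ (lookup u))
  injective? = map′ (λ inj {i} {j} → inj i j) (λ inj i j → inj {i} {j})
    (Fin.all? λ i → Fin.all? λ j → (lookup u i Fin.≟ lookup u j) →-dec (i Fin.≟ j))

  surjective? = map′ strictlySurjective⇒surjective surjective⇒strictlySurjective
    (Fin.all? λ j → Fin.any? λ i → lookup u i Fin.≟ j)

permutations : (m : ℕ) → List (Vec (Fin m) m)
permutations m = filter isPermutation? (vectors (allFin m) m)

exc : ∀ {m} → Vec (Fin m) m → ℕ
exc {m} u = count (λ i → i Fin.<? lookup u i) (Vec.allFin m)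

des : ∀ {m} → Vec (Fin (suc m)) (suc m) → ℕ
des {m} u = count (λ i → lookup u (suc i) Fin.<? lookup u (inject₁ i)) (Vec.allFin m)

IsDerangement : ∀ {m} → Vec (Fin m) m → Set
IsDerangement u = ¬ (∃[ i ] lookup u i ≡ i)

isDerangement? : ∀ {m} → Decidable (IsDerangement {m})
isDerangement? u = ¬? (Fin.any? λ i → lookup u i Fin.≟ i)

-- A 0 is a convention, and is not the sum over the one permutation of ∅.

A : ℕ → ℕ[x]
A zero      = 0ₚ
A m@(suc _) = ∑ (permutations m) (x^ ∘ des)

-- Here the general formula already gives the conventional value d 0 = 1.

d : ℕ → ℕ[x]
d m = ∑ (filter isDerangement? (permutations m)) (x^ ∘ exc)

d₀≈1 : d 0 ≈ 1ₚ
d₀≈1 _ = refl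

-- A signed permutation (S , w) of [n].  The vector ε of signs gives the set
-- S = {a₁, …, aₙ} with aᵢ = εᵢ i, and the bijection w : S → S is recorded by the
-- permutation σ of the indices with w(aᵢ) = a_σ(i).

SignedPermutation : ℕ → Set
SignedPermutation n = Vec Sign n × Vec (Fin n) n

signedPermutations : (n : ℕ) → List (SignedPermutation n)
signedPermutations n =
  cartesianProduct (vectors (Sign.+ ∷ Sign.- ∷ []) n) (permutations n)

element : ∀ {n} → SignedPermutation n → Fin n → ℤ
element (ε , σ) i = lookup ε i ◃ suc (toℕ i)

-- image w i is w(aᵢ).

image : ∀ {n} → SignedPermutation n → Fin n → ℤ
image w@(ε , σ) i = element w (lookup σ i)

IsBExcedance : ∀ {n} → SignedPermutation n → Fin n → Set
IsBExcedance w i =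
  element w i ℤ.< image w i ⊎ (element w i ℤ.< 0ℤ × image w i ≡ element w i)

isBExcedance? : ∀ {n} (w : SignedPermutation n) → Decidable (IsBExcedance w)
isBExcedance? w i =
  (element w i ℤ.<? image w i)
    ⊎-dec ((element w i ℤ.<? 0ℤ) ×-dec (image w i ℤ.≟ element w i))

excB : ∀ {n} → SignedPermutation n → ℕ
excB {n} w = count (isBExcedance? w) (Vec.allFin n)

IsBDerangement : ∀ {n} → SignedPermutation n → Set
IsBDerangement w = ¬ (∃[ i ] 0ℤ ℤ.< element w i × image w i ≡ element w i)

isBDerangement? : ∀ {n} → Decidable (IsBDerangement {n})
isBDerangement? w =
  ¬? (Fin.any? λ i → (0ℤ ℤ.<? element w i) ×-dec (image w i ℤ.≟ element w i))

dB : ℕ → ℕ[x]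
dB n = ∑ (filter isBDerangement? (signedPermutations n)) (x^ ∘ excB)

dB₀≈1 : dB 0 ≈ 1ₚ
dB₀≈1 _ = refl

factorials : ∀ {k} → Vec ℕ k → ℕ
factorials []       = 1
factorials (r ∷ rs) = r ! * factorials rs

factorials≢0 : ∀ {k} (rs : Vec ℕ k) → NonZero (factorials rs)
factorials≢0 []       = _
factorials≢0 (r ∷ rs) = m*n≢0 (r !) (factorials rs) {{r !≢0}} {{factorials≢0 rs}}

-- Used only for rs with sum n, where the division is exact.

multinomial : ∀ {k} → ℕ → Vec ℕ k → ℕ
multinomial n rs = (n ! / factorials rs) {{factorials≢0 rs}}

-- All sequences (r₀, …, rₖ) of nonnegative integers with sum n; bounding the
-- entries by n loses none of them.

sequences : (n k : ℕ) → List (Vec ℕ (suc k))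
sequences n k = filter (λ r → Vec.sum r ≟ n) (vectors (upTo (suc n)) (suc k))

summand : (n k : ℕ) → Vec ℕ (suc k) → ℕ[x]
summand n k r@(r₀ ∷ rs) =
  multinomial n r · (x^ ⌊ k + 1 /2⌋ ⊗ d r₀ ⊗ ∏ (Vec.map A rs))

{-# OPTIONS --safe #-}
module Submission where

-- Write α, δ, β for the exponential generating functions in t of A, d and dB.
-- A polynomial over ℕ is determined by its value at one large x, so x is a fixed
-- natural number throughout.  Inserting a largest letter into the cycles of a
-- permutation and a smallest letter into its one-line notation leads to the same
-- recurrence for excedances, for weak excedances less one and for descents;
-- sorting by fixed points, this gives
--
--   1 + α = exp(t) δ,    1 + x α = exp(x t) δ.
--
-- In a signed permutation each letter that is not fixed may carry either sign,
-- and the fixed ones are negative B-excedances, so β = exp(x t) δ(2t).  Since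
-- (exp(x t) − x exp(t)) δ = 1 − x, also after t ↦ 2t, these combine to
--
--   β = δ + x α δ + x α² β,
--
-- and iterating this equation yields the sum, because α vanishes at t = 0.

open import Algebra.Bundles using (CommutativeSemiring)
import Algebra.Construct.Pointwise as Pointwise
import Algebra.Properties.CommutativeSemigroup as CommutativeSemigroup
import Algebra.Solver.Ring.NaturalCoefficients.Default as SemiringSolver
open import Algebra.Structures.Biased using (isCommutativeSemiringˡ)
open import Data.Bool.Base using (Bool; true; false; if_then_else_)
open import Data.Fin.Base as Fin using (Fin; zero; suc; toℕ; inject₁; fromℕ; punchIn; punchOut)
open import Data.Fin.Permutation.Components using (transpose; transpose-inverse)
import Data.Fin.Properties as Fin
open import Data.Fin.Relation.Unary.Top using (view; ‵fromℕ; ‵inject₁; view-fromℕ; view-inject₁)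
open import Data.Integer.Base as ℤ using (ℤ; 0ℤ; _◃_)
import Data.Integer.Properties as ℤ
open import Data.List.Base as List
  using (List; []; _∷_; map; filter; cartesianProduct; cartesianProductWith; allFin; upTo)
open import Data.List.Membership.Propositional using (_∈_)
open import Data.List.Membership.Propositional.Properties
  using (∈-map⁺; ∈-map⁻; ∈-filter⁺; ∈-filter⁻; ∈-cartesianProductWith⁺; ∈-cartesianProduct⁺;
         ∈-cartesianProduct⁻; ∈-allFin)
open import Data.List.Membership.Propositional.Properties.WithK using (unique∧set⇒bag)
open import Data.List.Properties using (map-∘; map-++; map-tabulate; upTo-∷ʳ)
open import Data.List.Relation.Binary.BagAndSetEquality using (∼bag⇒↭)
open import Data.List.Relation.Binary.Permutation.Propositional using (_↭_)
import Data.List.Relation.Binary.Permutation.Propositional.Properties as ↭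
import Data.List.Relation.Unary.All as All
import Data.List.Relation.Unary.AllPairs as AllPairs
open import Data.List.Relation.Unary.Any using (here)
open import Data.List.Relation.Unary.Unique.Propositional using (Unique)
import Data.List.Relation.Unary.Unique.Propositional.Properties as Unique
open import Data.Nat.Base
open import Data.Nat.Combinatorics
  using (_C_; nCk≡n!/k![n-k]!; k>n⇒nCk≡0; nCk+nC[k+1]≡[n+1]C[k+1]; k![n∸k]!∣n!)
open import Data.Nat.Divisibility using (_∣_; ∣-refl; ∣-trans; *-monoʳ-∣)
open import Data.Nat.DivMod using (_%_; [m+kn]%n≡m%n; m<n⇒m%n≡m; m/n*n≡m)
open import Data.Nat.ListAction using (sum)
open import Data.Nat.ListAction.Properties using (sum-++; sum-↭)
open import Data.Nat.Properties
open import Data.Nat.Tactic.RingSolver using (solve-∀)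
open import Data.Product.Base using (_×_; _,_; ∃-syntax; proj₁; proj₂; uncurry)
open import Data.Sign.Base as Sign using (Sign)
open import Data.Sum.Base using (_⊎_; inj₁; inj₂)
open import Data.Vec.Base as Vec using (Vec; []; _∷_; _∷ʳ_; lookup; tabulate; count; insertAt)
import Data.Vec.Properties as Vec
open import Defs
open import Function.Base using (_∘_)
open import Function.Bundles using (_⇔_; mk⇔)
open import Function.Consequences.Propositional using (strictlySurjective⇒surjective)
open import Function.Definitions using (Injective; StrictlySurjective)
open import Level using (0ℓ)
open import Relation.Binary.PropositionalEquality
  using (_≡_; _≢_; _≗_; refl; sym; trans; cong; cong₂; subst; subst₂; module ≡-Reasoning)
import Relation.Binary.Reasoning.Setoid as SetoidReasoning
open import Relation.Nullary.Decidable
  using (Dec; does; yes; no; dec-true; dec-false; does-⇔; decidable-stable; _×-dec_; _⊎-dec_)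
open import Relation.Nullary.Negation.Core using (¬_; contradiction)
open import Relation.Unary using (Decidable)

open CommutativeSemigroup +-commutativeSemigroup using () renaming (interchange to +-interchange)
open CommutativeSemigroup *-commutativeSemigroup using () renaming (interchange to *-interchange)

-- Apart from the two insertions, no bijections between permutations are needed. A sum is always
-- taken of an arbitrary function f of the numbers of indices of each kind, and inserting a letter
-- turns the sum of f over n + 1 letters into the sum over n letters of another such function.
-- Growth is thus a linear operator on f, and an identity for all n reduces to the case n = 0 and a
-- compatibility between operators. Leaving f arbitrary is essential, because the induction
-- hypothesis is used at the transformed f.
--
-- The equation for β says β (1 - x α²) = δ (1 + x α). In the resulting geometric series the two
-- summands of the numerator give the even and the odd powers of α, which is the origin of the
-- exponent ⌊(k + 1)/2⌋. Natural numbers cannot be subtracted, so x is written as 1 + y, the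
-- equation is proved with a common summand and a common factor y on both sides, and these are
-- cancelled coefficient by coefficient. The cancellation asks for x to be at least 2.

private
  variable
    m n N : ℕ
    I J K : Set

-- The algebraic identity behind the functional equation

module _ {c ℓ} (R : CommutativeSemiring c ℓ) where

  open CommutativeSemiring R hiding (zero) renaming (_≈_ to _≋_; _+_ to _+ᴿ_; _*_ to _*ᴿ_; refl to ≋-refl; sym to ≋-sym)
  open SemiringSolver R
  open SetoidReasoning setoid

  -- With E = exp t and X = exp (x t), where x = 1 + y, the hypotheses express α
  -- and β through δ, E and X.  The conclusion is y times the desired equation;
  -- the summand w appears because there is no subtraction.

  excedance-identity : ∀ {y α β δ δ₂ E X} →
    1# +ᴿ α ≋ E *ᴿ δ → 1# +ᴿ (1# +ᴿ y) *ᴿ α ≋ X *ᴿ δ → β ≋ X *ᴿ δ₂ →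
    X *ᴿ X *ᴿ δ₂ +ᴿ y ≋ (1# +ᴿ y) *ᴿ (E *ᴿ E *ᴿ δ₂) →
    let w = X *ᴿ δ *ᴿ (X *ᴿ δ) *ᴿ β in
    w +ᴿ y *ᴿ β ≋ w +ᴿ y *ᴿ (δ +ᴿ (1# +ᴿ y) *ᴿ (α *ᴿ δ) +ᴿ (1# +ᴿ y) *ᴿ (α *ᴿ (α *ᴿ β)))
  excedance-identity {y} {α} {β} {δ} {δ₂} {E} {X} α-E α-X β-X δ₂-eq = begin
    X *ᴿ δ *ᴿ (X *ᴿ δ) *ᴿ β +ᴿ y *ᴿ β
      ≈⟨ +-congʳ (*-congʳ (*-cong (≋-sym α-X) (≋-sym α-X))) ⟩
    (1# +ᴿ (1# +ᴿ y) *ᴿ α) *ᴿ (1# +ᴿ (1# +ᴿ y) *ᴿ α) *ᴿ β +ᴿ y *ᴿ β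
      -- With x = 1 + y one has (1 + x α)² + y = x (1 + α)² + y x α²; the last term is the source of
      -- x α² β.
      ≈⟨ solve 3 (λ y α β →
           (con 1 :+ (con 1 :+ y) :* α) :* (con 1 :+ (con 1 :+ y) :* α) :* β :+ y :* β
           := (con 1 :+ y) :* ((con 1 :+ α) :* (con 1 :+ α) :* β) :+ y :* ((con 1 :+ y) :* (α :* (α :* β))))
         ≋-refl y α β ⟩
    (1# +ᴿ y) *ᴿ ((1# +ᴿ α) *ᴿ (1# +ᴿ α) *ᴿ β) +ᴿ y *ᴿ ((1# +ᴿ y) *ᴿ (α *ᴿ (α *ᴿ β)))
      ≈⟨ +-congʳ (*-congˡ (*-cong (*-cong α-E α-E) β-X)) ⟩
    (1# +ᴿ y) *ᴿ (E *ᴿ δ *ᴿ (E *ᴿ δ) *ᴿ (X *ᴿ δ₂)) +ᴿ y *ᴿ ((1# +ᴿ y) *ᴿ (α *ᴿ (α *ᴿ β)))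
      ≈⟨ +-congʳ (solve 5 (λ x E δ X δ₂ →
           x :* (E :* δ :* (E :* δ) :* (X :* δ₂)) := x :* (E :* E :* δ₂) :* (δ :* (X :* δ)))
         ≋-refl (1# +ᴿ y) E δ X δ₂) ⟩
    (1# +ᴿ y) *ᴿ (E *ᴿ E *ᴿ δ₂) *ᴿ (δ *ᴿ (X *ᴿ δ)) +ᴿ y *ᴿ ((1# +ᴿ y) *ᴿ (α *ᴿ (α *ᴿ β)))
      -- Trading x E² δ₂ for X² δ₂ + y recreates the summand w and leaves a multiple of y.
      ≈⟨ +-congʳ (*-congʳ (≋-sym δ₂-eq)) ⟩
    (X *ᴿ X *ᴿ δ₂ +ᴿ y) *ᴿ (δ *ᴿ (X *ᴿ δ)) +ᴿ y *ᴿ ((1# +ᴿ y) *ᴿ (α *ᴿ (α *ᴿ β)))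
      ≈⟨ solve 5 (λ y X δ δ₂ r →
           (X :* X :* δ₂ :+ y) :* (δ :* (X :* δ)) :+ y :* r
           := X :* δ :* (X :* δ) :* (X :* δ₂) :+ y :* (δ :* (X :* δ) :+ r))
         ≋-refl y X δ δ₂ ((1# +ᴿ y) *ᴿ (α *ᴿ (α *ᴿ β))) ⟩
    X *ᴿ δ *ᴿ (X *ᴿ δ) *ᴿ (X *ᴿ δ₂) +ᴿ y *ᴿ (δ *ᴿ (X *ᴿ δ) +ᴿ (1# +ᴿ y) *ᴿ (α *ᴿ (α *ᴿ β)))
      ≈⟨ +-cong (*-congˡ (≋-sym β-X)) (*-congˡ (+-congʳ (*-congˡ (≋-sym α-X)))) ⟩
    X *ᴿ δ *ᴿ (X *ᴿ δ) *ᴿ β +ᴿ y *ᴿ (δ *ᴿ (1# +ᴿ (1# +ᴿ y) *ᴿ α) +ᴿ (1# +ᴿ y) *ᴿ (α *ᴿ (α *ᴿ β)))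
      ≈⟨ +-congˡ (*-congˡ (+-congʳ (solve 3 (λ δ x α →
           δ :* (con 1 :+ x :* α) := δ :+ x :* (α :* δ)) ≋-refl δ (1# +ᴿ y) α))) ⟩
    X *ᴿ δ *ᴿ (X *ᴿ δ) *ᴿ β +ᴿ y *ᴿ (δ +ᴿ (1# +ᴿ y) *ᴿ (α *ᴿ δ) +ᴿ (1# +ᴿ y) *ᴿ (α *ᴿ (α *ᴿ β))) ∎

open ≡-Reasoning

-- Finite sums over lists

sumOver : List I → (I → ℕ) → ℕ
sumOver is f = sum (map f is)

infix 5 sumOver
syntax sumOver is (λ i → e) = Σ[ i ∈ is ] e

sumOver-cong : (is : List I) {f g : I → ℕ} → (∀ i → f i ≡ g i) → sumOver is f ≡ sumOver is g
sumOver-cong []       f≗g = refl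
sumOver-cong (i ∷ is) f≗g = cong₂ _+_ (f≗g i) (sumOver-cong is f≗g)

sumOver-+ : (is : List I) (f g : I → ℕ) →
            sumOver is (λ i → f i + g i) ≡ sumOver is f + sumOver is g
sumOver-+ []       f g = refl
sumOver-+ (i ∷ is) f g =
  trans (cong (f i + g i +_) (sumOver-+ is f g)) (+-interchange (f i) _ _ _)

sumOver-* : (c : ℕ) (is : List I) (f : I → ℕ) →
            sumOver is (λ i → c * f i) ≡ c * sumOver is f
sumOver-* c []       f = sym (*-zeroʳ c)
sumOver-* c (i ∷ is) f =
  trans (cong (c * f i +_) (sumOver-* c is f)) (sym (*-distribˡ-+ c (f i) _))

sumOver-0 : (is : List I) → sumOver is (λ _ → 0) ≡ 0
sumOver-0 []       = refl
sumOver-0 (_ ∷ is) = sumOver-0 is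

sumOver-map : (φ : I → J) (is : List I) (f : J → ℕ) →
              sumOver (map φ is) f ≡ sumOver is (f ∘ φ)
sumOver-map φ is f = cong sum (sym (map-∘ is))

sumOver-++ : (is js : List I) (f : I → ℕ) →
             sumOver (is List.++ js) f ≡ sumOver is f + sumOver js f
sumOver-++ is js f = trans (cong sum (map-++ f is js)) (sum-++ (map f is) _)

sumOver-cartesianProductWith : (φ : I → J → K) (is : List I) (js : List J) (f : K → ℕ) →
  sumOver (cartesianProductWith φ is js) f ≡ Σ[ i ∈ is ] Σ[ j ∈ js ] f (φ i j)
sumOver-cartesianProductWith φ []       js f = refl
sumOver-cartesianProductWith φ (i ∷ is) js f =
  trans (sumOver-++ (map (φ i) js) _ f)
        (cong₂ _+_ (sumOver-map (φ i) js f) (sumOver-cartesianProductWith φ is js f))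

sumOver-filter : {P : I → Set} (P? : Decidable P) (is : List I) (f : I → ℕ) →
  sumOver (filter P? is) f ≡ Σ[ i ∈ is ] (if does (P? i) then f i else 0)
sumOver-filter P? []       f = refl
sumOver-filter P? (i ∷ is) f with does (P? i)
... | true  = cong (f i +_) (sumOver-filter P? is f)
... | false = sumOver-filter P? is f

sumOver-swap : (is : List I) (js : List J) (f : I → J → ℕ) →
               sumOver is (λ i → sumOver js (f i)) ≡ (Σ[ j ∈ js ] Σ[ i ∈ is ] f i j)
sumOver-swap []       js f = sym (sumOver-0 js)
sumOver-swap (i ∷ is) js f =
  trans (cong (sumOver js (f i) +_) (sumOver-swap is js f)) (sym (sumOver-+ js (f i) _))

-- Lists without repetitions that have the same members are permutations of each other, so it is
-- enough to compare membership in `map φ is` and in `js`.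
sumOver-reindex : {is : List I} {js : List J} (φ : I → J) → Injective _≡_ _≡_ φ →
  Unique is → Unique js →
  (∀ {i} → i ∈ is → φ i ∈ js) → (∀ {j} → j ∈ js → ∃[ i ] i ∈ is × j ≡ φ i) →
  (f : J → ℕ) → sumOver js f ≡ sumOver is (f ∘ φ)
sumOver-reindex {is = is} {js} φ φ-inj is! js! to from f =
  trans (sym (sum-↭ (↭.map⁺ f map↭))) (sumOver-map φ is f)
  where
  map↭ : map φ is ↭ js
  map↭ = ∼bag⇒↭ (unique∧set⇒bag (Unique.map⁺ φ-inj is!) js! (mk⇔
    (λ j∈ → let (i , i∈ , j≡) = ∈-map⁻ φ j∈ in subst (_∈ js) (sym j≡) (to i∈))
    (λ j∈ → let (i , i∈ , j≡) = from j∈ in subst (_∈ map φ is) (sym j≡) (∈-map⁺ φ i∈))))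

-- `vectors` extends a vector at the front, but the sign of a new largest letter belongs at the end.
sumOver-vectors-∷ʳ : (is : List I) (n : ℕ) (f : Vec I (suc n) → ℕ) →
  sumOver (vectors is (suc n)) f ≡ Σ[ v ∈ vectors is n ] Σ[ i ∈ is ] f (v ∷ʳ i)
sumOver-vectors-∷ʳ is zero    f = begin
  sumOver (vectors is 1) f          ≡⟨ sumOver-cartesianProductWith _∷_ is (vectors is 0) f ⟩
  (Σ[ i ∈ is ] (f (i ∷ []) + 0))    ≡⟨ sumOver-cong is (λ i → +-identityʳ _) ⟩
  (Σ[ i ∈ is ] f (i ∷ []))          ≡⟨ +-identityʳ _ ⟨
  (Σ[ i ∈ is ] f (i ∷ [])) + 0      ∎
sumOver-vectors-∷ʳ is (suc n) f = begin
  sumOver (vectors is (2 + n)) f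
    ≡⟨ sumOver-cartesianProductWith _∷_ is (vectors is (suc n)) f ⟩
  (Σ[ i ∈ is ] Σ[ v ∈ vectors is (suc n) ] f (i ∷ v))
    ≡⟨ sumOver-cong is (λ i → sumOver-vectors-∷ʳ is n (f ∘ (i ∷_))) ⟩
  (Σ[ i ∈ is ] Σ[ v ∈ vectors is n ] Σ[ j ∈ is ] f (i ∷ (v ∷ʳ j)))
    ≡⟨ sumOver-cartesianProductWith _∷_ is (vectors is n) _ ⟨
  (Σ[ v ∈ vectors is (suc n) ] Σ[ j ∈ is ] f (v ∷ʳ j)) ∎

sumOver-upTo-suc : (n : ℕ) (f : ℕ → ℕ) →
  sumOver (List.upTo (suc n)) f ≡ f 0 + sumOver (List.upTo n) (f ∘ suc)
sumOver-upTo-suc n f = cong (λ l → f 0 + sum l) (go (λ i → i) n)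
  where
  go : (g : ℕ → ℕ) (n : ℕ) → map f (List.applyUpTo (suc ∘ g) n) ≡ map (f ∘ suc) (List.applyUpTo g n)
  go g zero    = refl
  go g (suc n) = cong (f (suc (g 0)) ∷_) (go (g ∘ suc) n)

-- Evaluation of polynomials

eval : ℕ → ℕ[x] → ℕ
eval x []      = 0
eval x (a ∷ p) = a + x * eval x p

eval-⊕ : ∀ x p q → eval x (p ⊕ q) ≡ eval x p + eval x q
eval-⊕ x []      q       = refl
eval-⊕ x (a ∷ p) []      = sym (+-identityʳ _)
eval-⊕ x (a ∷ p) (b ∷ q) = trans (cong (λ e → a + b + x * e) (eval-⊕ x p q)) (go a b x _ _)
  where
  go : ∀ a b x y z → a + b + x * (y + z) ≡ (a + x * y) + (b + x * z)
  go = solve-∀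

eval-· : ∀ x c p → eval x (c · p) ≡ c * eval x p
eval-· x c []      = sym (*-zeroʳ c)
eval-· x c (a ∷ p) = trans (cong (λ e → c * a + x * e) (eval-· x c p)) (go c a x _)
  where
  go : ∀ c a x y → c * a + x * (c * y) ≡ c * (a + x * y)
  go = solve-∀

eval-⊗ : ∀ x p q → eval x (p ⊗ q) ≡ eval x p * eval x q
eval-⊗ x []      q = refl
eval-⊗ x (a ∷ p) q = begin
  eval x (a · q ⊕ (0 ∷ p ⊗ q))           ≡⟨ eval-⊕ x (a · q) _ ⟩
  eval x (a · q) + x * eval x (p ⊗ q)    ≡⟨ cong₂ (λ y z → y + x * z) (eval-· x a q) (eval-⊗ x p q) ⟩
  a * eval x q + x * (eval x p * eval x q) ≡⟨ go a x _ _ ⟩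
  (a + x * eval x p) * eval x q          ∎
  where
  go : ∀ a x y z → a * z + x * (y * z) ≡ (a + x * y) * z
  go = solve-∀

eval-1ₚ : ∀ x → eval x 1ₚ ≡ 1
eval-1ₚ x = cong suc (*-zeroʳ x)

eval-x^ : ∀ x j → eval x (x^ j) ≡ x ^ j
eval-x^ x zero    = eval-1ₚ x
eval-x^ x (suc j) = cong (x *_) (eval-x^ x j)

eval-∑ : ∀ x (is : List I) (f : I → ℕ[x]) → eval x (∑ is f) ≡ sumOver is (eval x ∘ f)
eval-∑ x []       f = refl
eval-∑ x (i ∷ is) f = trans (eval-⊕ x (f i) _) (cong (eval x (f i) +_) (eval-∑ x is f))

-- A polynomial is determined by its value at any x exceeding all of its
-- coefficients, which are then its digits in base x.

eval-zero : ∀ x .{{_ : NonZero x}} p → eval x p ≡ 0 → p ≈ 0ₚ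
eval-zero x []      _  j       = refl
eval-zero x (a ∷ p) eq zero    = m+n≡0⇒m≡0 a eq
eval-zero x@(suc x-1) (a ∷ p) eq (suc j) =
  eval-zero x p (m+n≡0⇒m≡0 (eval x p) (m+n≡0⇒n≡0 a eq)) j

digits-unique : ∀ x {a b p q} .{{_ : NonZero x}} → a < x → b < x →
                a + x * p ≡ b + x * q → a ≡ b × p ≡ q
digits-unique x {a} {b} {p} {q} a<x b<x eq = a≡b , *-cancelˡ-≡ p q x (+-cancelˡ-≡ a _ _ (trans eq (cong (_+ x * q) (sym a≡b))))
  where
  digit : ∀ {a} p → a < x → (a + x * p) % x ≡ a
  digit {a} p a<x = trans (cong (λ e → (a + e) % x) (*-comm x p))
                          (trans ([m+kn]%n≡m%n a p x) (m<n⇒m%n≡m a<x))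
  a≡b : a ≡ b
  a≡b = trans (sym (digit p a<x)) (trans (cong (_% x) eq) (digit q b<x))

eval-injective : ∀ x p q → sum p < x → sum q < x → eval x p ≡ eval x q → p ≈ q
eval-injective x@(suc _) []      q  _ _ eq j = sym (eval-zero x q (sym eq) j)
eval-injective x@(suc _) (a ∷ p) [] _ _ eq j = eval-zero x (a ∷ p) eq j
eval-injective x@(suc _) (a ∷ p) (b ∷ q) ap<x bq<x eq
  with digits-unique x (≤-<-trans (m≤m+n a (sum p)) ap<x) (≤-<-trans (m≤m+n b (sum q)) bq<x) eq
... | a≡b , eq′ = λ where
  zero    → a≡b
  (suc j) → eval-injective x p q (≤-<-trans (m≤n+m _ a) ap<x) (≤-<-trans (m≤n+m _ b) bq<x) eq′ j

-- Values below 2 are left out because x - 1 has to be cancelled later on; the value actually used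
-- exceeds both coefficient sums.
≈-from-eval : ∀ p q → (∀ x → eval (2 + x) p ≡ eval (2 + x) q) → p ≈ q
≈-from-eval p q eq = eval-injective (2 + (sum p + sum q)) p q
  (s≤s (m≤n⇒m≤1+n (m≤m+n _ _))) (s≤s (m≤n⇒m≤1+n (m≤n+m _ _))) (eq _)

-- Exponential generating functions

-- A sequence f stands for its exponential generating function ∑ f n tⁿ/n!.
-- The derivative is then the shift f ∘ suc, and the product is determined by
-- its value at 0 and the Leibniz rule.

Seq : Set
Seq = ℕ → ℕ

infixl 7 _⋆_
infixl 6 _⊞_

_⊞_ : Seq → Seq → Seq
(f ⊞ g) n = f n + g n

_⋆_ : Seq → Seq → Seq
(f ⋆ g) zero    = f 0 * g 0
(f ⋆ g) (suc n) = (f ∘ suc ⋆ g) n + (f ⋆ g ∘ suc) n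

const : ℕ → Seq
const c zero    = c
const c (suc _) = 0

⋆-cong : ∀ {f f′ g g′} → f ≗ f′ → g ≗ g′ → f ⋆ g ≗ f′ ⋆ g′
⋆-cong f≗ g≗ zero    = cong₂ _*_ (f≗ 0) (g≗ 0)
⋆-cong f≗ g≗ (suc n) = cong₂ _+_ (⋆-cong (f≗ ∘ suc) g≗ n) (⋆-cong f≗ (g≗ ∘ suc) n)

-- Coefficient n of a product sees no index above n. This refinement is needed because
-- `multinomialSum N` is identified with a power only at indices below N.
⋆-cong≤ : ∀ {n g g′} f → (∀ {m} → m ≤ n → g m ≡ g′ m) → (f ⋆ g) n ≡ (f ⋆ g′) n
⋆-cong≤ {zero}  f g≡ = cong (f 0 *_) (g≡ z≤n)
⋆-cong≤ {suc n} f g≡ = cong₂ _+_ (⋆-cong≤ (f ∘ suc) (g≡ ∘ m≤n⇒m≤1+n)) (⋆-cong≤ f (g≡ ∘ s≤s))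

⋆-comm : ∀ f g → f ⋆ g ≗ g ⋆ f
⋆-comm f g zero    = *-comm (f 0) (g 0)
⋆-comm f g (suc n) = trans (cong₂ _+_ (⋆-comm (f ∘ suc) g n) (⋆-comm f (g ∘ suc) n)) (+-comm ((g ⋆ f ∘ suc) n) _)

⋆-zeroˡ : ∀ f → (λ _ → 0) ⋆ f ≗ (λ _ → 0)
⋆-zeroˡ f zero    = refl
⋆-zeroˡ f (suc n) = cong₂ _+_ (⋆-zeroˡ f n) (⋆-zeroˡ (f ∘ suc) n)

⋆-distribʳ : ∀ h f g → (f ⊞ g) ⋆ h ≗ f ⋆ h ⊞ g ⋆ h
⋆-distribʳ h f g zero    = *-distribʳ-+ (h 0) (f 0) (g 0)
⋆-distribʳ h f g (suc n) =
  trans (cong₂ _+_ (⋆-distribʳ h (f ∘ suc) (g ∘ suc) n) (⋆-distribʳ (h ∘ suc) f g n))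
        (+-interchange ((f ∘ suc ⋆ h) n) _ _ _)

⋆-distribˡ : ∀ h f g → h ⋆ (f ⊞ g) ≗ h ⋆ f ⊞ h ⋆ g
⋆-distribˡ h f g n = begin
  (h ⋆ (f ⊞ g)) n        ≡⟨ ⋆-comm h (f ⊞ g) n ⟩
  ((f ⊞ g) ⋆ h) n        ≡⟨ ⋆-distribʳ h f g n ⟩
  (f ⋆ h) n + (g ⋆ h) n  ≡⟨ cong₂ _+_ (⋆-comm f h n) (⋆-comm g h n) ⟩
  (h ⋆ f) n + (h ⋆ g) n  ∎

⋆-assoc : ∀ f g h → (f ⋆ g) ⋆ h ≗ f ⋆ (g ⋆ h)
⋆-assoc f g h zero    = *-assoc (f 0) (g 0) (h 0)
⋆-assoc f g h (suc n) = begin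
  ((f ∘ suc ⋆ g ⊞ f ⋆ g ∘ suc) ⋆ h) n + ((f ⋆ g) ⋆ h ∘ suc) n
    ≡⟨ cong (_+ ((f ⋆ g) ⋆ h ∘ suc) n) (⋆-distribʳ h (f ∘ suc ⋆ g) (f ⋆ g ∘ suc) n) ⟩
  ((f ∘ suc ⋆ g) ⋆ h) n + ((f ⋆ g ∘ suc) ⋆ h) n + ((f ⋆ g) ⋆ h ∘ suc) n
    ≡⟨ +-assoc (((f ∘ suc ⋆ g) ⋆ h) n) _ _ ⟩
  ((f ∘ suc ⋆ g) ⋆ h) n + (((f ⋆ g ∘ suc) ⋆ h) n + ((f ⋆ g) ⋆ h ∘ suc) n)
    ≡⟨ cong₂ _+_ (⋆-assoc (f ∘ suc) g h n) (cong₂ _+_ (⋆-assoc f (g ∘ suc) h n) (⋆-assoc f g (h ∘ suc) n)) ⟩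
  (f ∘ suc ⋆ (g ⋆ h)) n + ((f ⋆ (g ∘ suc ⋆ h)) n + (f ⋆ (g ⋆ h ∘ suc)) n)
    ≡⟨ cong ((f ∘ suc ⋆ (g ⋆ h)) n +_) (⋆-distribˡ f (g ∘ suc ⋆ h) (g ⋆ h ∘ suc) n) ⟨
  (f ⋆ (g ⋆ h)) (suc n) ∎

const-⋆ : ∀ c f n → (const c ⋆ f) n ≡ c * f n
const-⋆ c f zero    = refl
const-⋆ c f (suc n) = cong₂ _+_ (⋆-zeroˡ f n) (const-⋆ c (f ∘ suc) n)

⋆-identityˡ : ∀ f → const 1 ⋆ f ≗ f
⋆-identityˡ f n = trans (const-⋆ 1 f n) (*-identityˡ (f n))

⋆-commutativeSemiring : CommutativeSemiring 0ℓ 0ℓ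
⋆-commutativeSemiring = record
  { Carrier = Seq
  ; _≈_     = _≗_
  ; _+_     = _⊞_
  ; _*_     = _⋆_
  ; 0#      = λ _ → 0
  ; 1#      = const 1
  ; isCommutativeSemiring = isCommutativeSemiringˡ record
    { +-isCommutativeMonoid = Pointwise.isCommutativeMonoid ℕ +-0-isCommutativeMonoid
    ; *-isCommutativeMonoid = record
      { isMonoid = record
        { isSemigroup = record
          { isMagma = record
            { isEquivalence = CommutativeSemiring.isEquivalence (Pointwise.commutativeSemiring ℕ +-*-commutativeSemiring)
            ; ∙-cong = ⋆-cong
            }
          ; assoc = ⋆-assoc
          }
        ; identity = ⋆-identityˡ , λ f n → trans (⋆-comm f (const 1) n) (⋆-identityˡ f n)
        }
      ; comm = ⋆-comm
      }
    ; distribʳ = ⋆-distribʳ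
    ; zeroˡ    = ⋆-zeroˡ
    }
  }

-- The substitution of c t for t.
scale : ℕ → Seq → Seq
scale c f n = c ^ n * f n

-- By the chain rule each derivative brings out a factor c, which is absorbed by the differentiated
-- factor of the corresponding Leibniz term.
scale-⋆ : ∀ c f g → scale c (f ⋆ g) ≗ scale c f ⋆ scale c g
scale-⋆ c f g zero    = trans (*-identityˡ _) (sym (cong₂ _*_ (*-identityˡ (f 0)) (*-identityˡ (g 0))))
scale-⋆ c f g (suc n) = begin
  c * c ^ n * ((f ∘ suc ⋆ g) n + (f ⋆ g ∘ suc) n)
    ≡⟨ rearrange c (c ^ n) _ _ ⟩
  c * scale c (f ∘ suc ⋆ g) n + c * scale c (f ⋆ g ∘ suc) n
    ≡⟨ cong₂ (λ a b → c * a + c * b) (scale-⋆ c (f ∘ suc) g n) (scale-⋆ c f (g ∘ suc) n) ⟩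
  c * (scale c (f ∘ suc) ⋆ scale c g) n + c * (scale c f ⋆ scale c (g ∘ suc)) n
    ≡⟨ cong₂ _+_ (pullˡ _ _ n) (trans (cong (c *_) (⋆-comm (scale c f) _ n)) (trans (pullˡ _ _ n) (⋆-comm _ (scale c f) n))) ⟩
  ((λ m → c * scale c (f ∘ suc) m) ⋆ scale c g) n + (scale c f ⋆ (λ m → c * scale c (g ∘ suc) m)) n
    ≡⟨ cong₂ _+_ (⋆-cong (λ m → sym (*-assoc c (c ^ m) _)) (λ _ → refl) n)
                 (⋆-cong {scale c f} (λ _ → refl) (λ m → sym (*-assoc c (c ^ m) _)) n) ⟩
  (scale c f ⋆ scale c g) (suc n) ∎
  where
  rearrange : ∀ c p a b → c * p * (a + b) ≡ c * (p * a) + c * (p * b)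
  rearrange = solve-∀

  pullˡ : ∀ f g n → c * (f ⋆ g) n ≡ ((λ m → c * f m) ⋆ g) n
  pullˡ f g n = begin
    c * (f ⋆ g) n            ≡⟨ const-⋆ c (f ⋆ g) n ⟨
    (const c ⋆ (f ⋆ g)) n    ≡⟨ ⋆-assoc (const c) f g n ⟨
    ((const c ⋆ f) ⋆ g) n    ≡⟨ ⋆-cong (const-⋆ c f) (λ _ → refl) n ⟩
    ((λ m → c * f m) ⋆ g) n  ∎

-- The generating function of y ^_ is exp (y t).

^-⋆ : ∀ y z → (y ^_) ⋆ (z ^_) ≗ ((y + z) ^_)
^-⋆ y z zero    = refl
^-⋆ y z (suc n) = begin
  ((λ m → y * y ^ m) ⋆ (z ^_)) n + ((y ^_) ⋆ (λ m → z * z ^ m)) n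
    ≡⟨ cong₂ _+_ (⋆-cong (λ m → sym (const-⋆ y (y ^_) m)) (λ _ → refl) n)
                 (⋆-cong {y ^_} (λ _ → refl) (λ m → sym (const-⋆ z (z ^_) m)) n) ⟩
  ((const y ⋆ (y ^_)) ⋆ (z ^_)) n + ((y ^_) ⋆ (const z ⋆ (z ^_))) n
    -- The product satisfies the differential equation F′ = (y + z) F.
    ≡⟨ solve 4 (λ Y Z f g → (Y :* f) :* g :+ f :* (Z :* g) := (Y :+ Z) :* (f :* g)) (λ _ → refl)
         (const y) (const z) (y ^_) (z ^_) n ⟩
  ((const y ⊞ const z) ⋆ ((y ^_) ⋆ (z ^_))) n
    ≡⟨ ⋆-cong (λ { zero → refl ; (suc _) → refl }) (λ _ → refl) n ⟩
  (const (y + z) ⋆ ((y ^_) ⋆ (z ^_))) n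
    ≡⟨ const-⋆ (y + z) _ n ⟩
  (y + z) * ((y ^_) ⋆ (z ^_)) n
    ≡⟨ cong ((y + z) *_) (^-⋆ y z n) ⟩
  (y + z) ^ suc n ∎
  where open SemiringSolver ⋆-commutativeSemiring

-- Order of vanishing

VanishesBelow : ℕ → Seq → Set
VanishesBelow k f = ∀ {n} → n < k → f n ≡ 0

⋆-vanishes : ∀ {n f g} → VanishesBelow (suc n) g → (f ⋆ g) n ≡ 0
⋆-vanishes {zero}  {f} g≡0 = trans (cong (f 0 *_) (g≡0 z<s)) (*-zeroʳ (f 0))
⋆-vanishes {suc n} {f} {g} g≡0 =
  cong₂ _+_ (⋆-vanishes {n} {f ∘ suc} (g≡0 ∘ m<n⇒m<1+n)) (⋆-vanishes {n} {f} (g≡0 ∘ s<s))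

-- In the Leibniz rule f′ g keeps the order k of g, while f g′ is the same claim with k lowered by
-- one.
⋆-vanishesBelow : ∀ {k f g} → f 0 ≡ 0 → VanishesBelow k g → VanishesBelow (suc k) (f ⋆ g)
⋆-vanishesBelow {k} {f} {g} f0≡0 g≡0 {zero} _ = cong (_* g 0) f0≡0
⋆-vanishesBelow {suc k} {f} {g} f0≡0 g≡0 {suc n} (s<s n<) =
  cong₂ _+_ (⋆-vanishes {n} {f ∘ suc} (λ m< → g≡0 (≤-trans m< n<))) (⋆-vanishesBelow f0≡0 (g≡0 ∘ s<s) n<)

infix 8 _⋆^_

_⋆^_ : Seq → ℕ → Seq
f ⋆^ zero  = const 1
f ⋆^ suc k = f ⋆ f ⋆^ k

⋆^-vanishesBelow : ∀ {f} k → f 0 ≡ 0 → VanishesBelow k (f ⋆^ k)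
⋆^-vanishesBelow (suc k) f0≡0 = ⋆-vanishesBelow f0≡0 (⋆^-vanishesBelow k f0≡0)

⋆^-⋆-vanishes : ∀ {f g k n} → f 0 ≡ 0 → n < k → (g ⋆ f ⋆^ k) n ≡ 0
⋆^-⋆-vanishes {f} {g} {k} {n} f0≡0 n<k =
  ⋆-vanishes {n} {g} (λ m< → ⋆^-vanishesBelow k f0≡0 (≤-trans m< n<k))

-- Binomial sums

-- Pascal's rule matches the Leibniz rule. The range N stays free above n, since surplus terms
-- vanish with their binomial coefficient; one N then serves all smaller indices at once.
⋆-binomial : ∀ {n N} f g → n < N → (f ⋆ g) n ≡ Σ[ r ∈ upTo N ] (n C r) * (f r * g (n ∸ r))
⋆-binomial {zero} {suc N} f g _ = begin
  f 0 * g 0                               ≡⟨ trans (+-identityʳ (f 0 * g 0 + 0)) (+-identityʳ _) ⟨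
  1 * (f 0 * g 0) + 0                     ≡⟨ cong (1 * (f 0 * g 0) +_) (sumOver-0 (upTo N)) ⟨
  1 * (f 0 * g 0) + sumOver (upTo N) (λ _ → 0)
    ≡⟨ cong (1 * (f 0 * g 0) +_) (sumOver-cong (upTo N) λ r → cong (_* (f (suc r) * g 0)) (sym (k>n⇒nCk≡0 {0} {suc r} z<s))) ⟩
  1 * (f 0 * g 0) + sumOver (upTo N) (λ r → (0 C suc r) * (f (suc r) * g 0))
    ≡⟨ sumOver-upTo-suc N (λ r → (0 C r) * (f r * g (0 ∸ r))) ⟨
  sumOver (upTo (suc N)) (λ r → (0 C r) * (f r * g (0 ∸ r))) ∎
⋆-binomial {suc n} {suc N} f g (s<s n<N) = begin
  (f ∘ suc ⋆ g) n + (f ⋆ g ∘ suc) n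
    ≡⟨ cong₂ _+_ (⋆-binomial (f ∘ suc) g n<N)
                 (trans (⋆-binomial f (g ∘ suc) (m<n⇒m<1+n n<N)) (sumOver-upTo-suc N (λ r → (n C r) * (f r * g (suc (n ∸ r)))))) ⟩
  sumOver (upTo N) left + (1 * (f 0 * g (suc n)) + sumOver (upTo N) right)
    ≡⟨ x+[y+z]≡y+[x+z] (sumOver (upTo N) left) (1 * (f 0 * g (suc n))) (sumOver (upTo N) right) ⟩
  1 * (f 0 * g (suc n)) + (sumOver (upTo N) left + sumOver (upTo N) right)
    ≡⟨ cong (1 * (f 0 * g (suc n)) +_) (sumOver-+ (upTo N) left right) ⟨
  1 * (f 0 * g (suc n)) + sumOver (upTo N) (λ r → left r + right r)
    ≡⟨ cong (1 * (f 0 * g (suc n)) +_) (sumOver-cong (upTo N) pascal) ⟩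
  1 * (f 0 * g (suc n)) + sumOver (upTo N) (λ r → (suc n C suc r) * (f (suc r) * g (n ∸ r)))
    ≡⟨ sumOver-upTo-suc N (λ r → (suc n C r) * (f r * g (suc n ∸ r))) ⟨
  sumOver (upTo (suc N)) (λ r → (suc n C r) * (f r * g (suc n ∸ r))) ∎
  where
  left right : ℕ → ℕ
  left  r = (n C r) * (f (suc r) * g (n ∸ r))
  right r = (n C suc r) * (f (suc r) * g (suc (n ∸ suc r)))

  x+[y+z]≡y+[x+z] : ∀ x y z → x + (y + z) ≡ y + (x + z)
  x+[y+z]≡y+[x+z] = solve-∀

  -- For r ≥ n the truncated subtractions disagree, but there the coefficient is 0.
  right≡ : ∀ r → right r ≡ (n C suc r) * (f (suc r) * g (n ∸ r))
  right≡ r with suc r ≤? n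
  ... | yes r<n = cong (λ m → (n C suc r) * (f (suc r) * g m)) (sym (+-∸-assoc 1 r<n))
  ... | no  r≮n = trans (cong (_* (f (suc r) * g (suc (n ∸ suc r)))) C≡0) (cong (_* (f (suc r) * g (n ∸ r))) (sym C≡0))
    where
    C≡0 : n C suc r ≡ 0
    C≡0 = k>n⇒nCk≡0 (≰⇒> r≮n)

  pascal : ∀ r → left r + right r ≡ (suc n C suc r) * (f (suc r) * g (n ∸ r))
  pascal r = begin
    left r + right r                                     ≡⟨ cong (left r +_) (right≡ r) ⟩
    left r + (n C suc r) * (f (suc r) * g (n ∸ r))       ≡⟨ *-distribʳ-+ (f (suc r) * g (n ∸ r)) (n C r) _ ⟨
    (n C r + n C suc r) * (f (suc r) * g (n ∸ r))        ≡⟨ cong (_* (f (suc r) * g (n ∸ r))) (nCk+nC[k+1]≡[n+1]C[k+1] n r) ⟩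
    (suc n C suc r) * (f (suc r) * g (n ∸ r))            ∎

-- Multinomial coefficients and multinomial sums

factorials∣sum! : ∀ {k} (v : Vec ℕ k) → factorials v ∣ Vec.sum v !
factorials∣sum! []      = ∣-refl
factorials∣sum! (r ∷ v) = ∣-trans (*-monoʳ-∣ (r !) (factorials∣sum! v))
  (subst (λ s → r ! * s ! ∣ (r + Vec.sum v) !) (m+n∸m≡n r (Vec.sum v)) (k![n∸k]!∣n! (m≤m+n r (Vec.sum v))))

multinomial-factorials : ∀ {k} (v : Vec ℕ k) → multinomial (Vec.sum v) v * factorials v ≡ Vec.sum v !
multinomial-factorials v = m/n*n≡m {{factorials≢0 v}} (factorials∣sum! v)

binomial-factorials : ∀ r s → ((r + s) C r) * (r ! * s !) ≡ (r + s) !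
binomial-factorials r s = begin
  ((r + s) C r) * (r ! * s !)
    ≡⟨ cong (λ m → ((r + s) C r) * (r ! * m !)) (m+n∸m≡n r s) ⟨
  ((r + s) C r) * (r ! * (r + s ∸ r) !)
    ≡⟨ cong (_* (r ! * (r + s ∸ r) !)) (nCk≡n!/k![n-k]! (m≤m+n r s)) ⟩
  ((r + s) ! / (r ! * (r + s ∸ r) !)) * (r ! * (r + s ∸ r) !)
    ≡⟨ m/n*n≡m (k![n∸k]!∣n! (m≤m+n r s)) ⟩
  (r + s) ! ∎
  where instance _ = r !* (r + s ∸ r) !≢0

-- Both sides become (r + s)! when multiplied by all the factorials; the divisions are exact, so
-- this common factor can be cancelled.
multinomial-∷ : ∀ {k} r (v : Vec ℕ k) → multinomial (r + Vec.sum v) (r ∷ v) ≡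
                ((r + Vec.sum v) C r) * multinomial (Vec.sum v) v
multinomial-∷ r v = *-cancelʳ-≡ _ _ (r ! * factorials v) {{factorials≢0 (r ∷ v)}} (begin
  multinomial (r + s) (r ∷ v) * (r ! * factorials v)  ≡⟨ multinomial-factorials (r ∷ v) ⟩
  (r + s) !                                           ≡⟨ binomial-factorials r s ⟨
  ((r + s) C r) * (r ! * s !)                         ≡⟨ cong (λ m → ((r + s) C r) * (r ! * m)) (multinomial-factorials v) ⟨
  ((r + s) C r) * (r ! * (multinomial s v * factorials v)) ≡⟨ rearrange ((r + s) C r) (r !) (multinomial s v) (factorials v) ⟩
  ((r + s) C r) * multinomial s v * (r ! * factorials v) ∎)
  where
  s = Vec.sum v
  rearrange : ∀ a b c d → a * (b * (c * d)) ≡ a * c * (b * d)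
  rearrange = solve-∀

-- The bound N on the entries is independent of n, so that this is a sequence in n whose smaller
-- values the recursion on k can use. For n < N the bound loses no vector.
multinomialSum : ℕ → (k : ℕ) → (Vec ℕ k → ℕ) → Seq
multinomialSum N k h n =
  Σ[ v ∈ vectors (upTo N) k ] (if does (Vec.sum v ≟ n) then multinomial n v * h v else 0)

-- With the head r summed first, `multinomial-∷` splits off n C r and leaves a multinomial sum at n
-- ∸ r. A head above n contributes 0 on both sides.
multinomialSum-∷ : ∀ {n N} k f (h : Vec ℕ k → ℕ) → n < N →
  multinomialSum N (suc k) (λ v → f (Vec.head v) * h (Vec.tail v)) n ≡ (f ⋆ multinomialSum N k h) n
multinomialSum-∷ {n} {N} k f h n<N = begin
  multinomialSum N (suc k) (λ v → f (Vec.head v) * h (Vec.tail v)) n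
    ≡⟨ sumOver-cartesianProductWith _∷_ (upTo N) (vectors (upTo N) k) _ ⟩
  (Σ[ r ∈ upTo N ] Σ[ v ∈ vectors (upTo N) k ] term r v)
    ≡⟨ sumOver-cong (upTo N) perHead ⟩
  (Σ[ r ∈ upTo N ] (n C r) * (f r * multinomialSum N k h (n ∸ r)))
    ≡⟨ ⋆-binomial f _ n<N ⟨
  (f ⋆ multinomialSum N k h) n ∎
  where
  term : ℕ → Vec ℕ k → ℕ
  term r v = if does (r + Vec.sum v ≟ n) then multinomial n (r ∷ v) * (f r * h v) else 0

  tailTerm : ℕ → Vec ℕ k → ℕ
  tailTerm m v = if does (Vec.sum v ≟ m) then multinomial m v * h v else 0

  rearrange : ∀ a b c d → a * b * (c * d) ≡ a * c * (b * d)
  rearrange = solve-∀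

  term≡ : ∀ r v → r ≤ n → term r v ≡ (n C r) * f r * tailTerm (n ∸ r) v
  term≡ r v r≤n with Vec.sum v ≟ n ∸ r
  ... | yes sum≡ rewrite dec-true (r + Vec.sum v ≟ n) (trans (cong (r +_) sum≡) (m+[n∸m]≡n r≤n))
                      | dec-true (Vec.sum v ≟ n ∸ r) sum≡ =
    trans (cong (_* (f r * h v)) (multinomial≡ sum≡ (m+[n∸m]≡n r≤n))) (rearrange (n C r) _ (f r) (h v))
    where
    multinomial≡ : ∀ {m} → Vec.sum v ≡ m → r + m ≡ n → multinomial n (r ∷ v) ≡ (n C r) * multinomial m v
    multinomial≡ refl refl = multinomial-∷ r v
  ... | no  sum≢
        rewrite dec-false (r + Vec.sum v ≟ n) (λ eq → sum≢ (trans (sym (m+n∸m≡n r _)) (cong (_∸ r) eq)))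
              | dec-false (Vec.sum v ≟ n ∸ r) sum≢
              = sym (*-zeroʳ ((n C r) * f r))

  perHead : ∀ r → sumOver (vectors (upTo N) k) (term r) ≡ (n C r) * (f r * multinomialSum N k h (n ∸ r))
  perHead r with r ≤? n
  ... | yes r≤n = begin
    sumOver (vectors (upTo N) k) (term r)
      ≡⟨ sumOver-cong (vectors (upTo N) k) (λ v → term≡ r v r≤n) ⟩
    sumOver (vectors (upTo N) k) (λ v → (n C r) * f r * tailTerm (n ∸ r) v)
      ≡⟨ sumOver-* ((n C r) * f r) (vectors (upTo N) k) (tailTerm (n ∸ r)) ⟩
    (n C r) * f r * multinomialSum N k h (n ∸ r)
      ≡⟨ *-assoc (n C r) (f r) _ ⟩
    (n C r) * (f r * multinomialSum N k h (n ∸ r)) ∎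
  ... | no  r≰n = begin
    sumOver (vectors (upTo N) k) (term r)
      ≡⟨ sumOver-cong (vectors (upTo N) k) (λ v → cong (if_then multinomial n (r ∷ v) * (f r * h v) else 0)
           (dec-false (r + Vec.sum v ≟ n) (λ eq → r≰n (m+n≤o⇒m≤o r (≤-reflexive eq))))) ⟩
    sumOver (vectors (upTo N) k) (λ _ → 0)
      ≡⟨ sumOver-0 (vectors (upTo N) k) ⟩
    0
      ≡⟨ cong (_* (f r * multinomialSum N k h (n ∸ r))) (k>n⇒nCk≡0 (≰⇒> r≰n)) ⟨
    (n C r) * (f r * multinomialSum N k h (n ∸ r)) ∎

product : ∀ {k} → Vec ℕ k → ℕ
product = Vec.foldr _ _*_ 1

multinomialSum-⋆^ : ∀ {n N} k f → n < N → multinomialSum N k (λ v → product (Vec.map f v)) n ≡ (f ⋆^ k) n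
multinomialSum-⋆^ {zero}  zero f _ = refl
multinomialSum-⋆^ {suc n} zero f _ = refl
multinomialSum-⋆^ {n} {N} (suc k) f n<N = begin
  multinomialSum N (suc k) (λ v → product (Vec.map f v)) n
    ≡⟨ sumOver-cong (vectors (upTo N) (suc k)) (λ { (r ∷ v) → refl }) ⟩
  multinomialSum N (suc k) (λ v → f (Vec.head v) * product (Vec.map f (Vec.tail v))) n
    ≡⟨ multinomialSum-∷ k f (product ∘ Vec.map f) n<N ⟩
  (f ⋆ multinomialSum N k (product ∘ Vec.map f)) n
    ≡⟨ ⋆-cong≤ f (λ m≤n → multinomialSum-⋆^ k f (≤-<-trans m≤n n<N)) ⟩
  (f ⋆ f ⋆^ k) n ∎

-- The functional equation and its iteration

module S = CommutativeSemiring ⋆-commutativeSemiring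

const-+ : ∀ b c → const b ⊞ const c ≗ const (b + c)
const-+ b c zero    = refl
const-+ b c (suc _) = refl

scale-const : ∀ b c → scale b (const c) ≗ const c
scale-const b c zero    = *-identityˡ c
scale-const b c (suc n) = *-zeroʳ (b ^ suc n)

^-distribʳ-* : ∀ n b c → (b * c) ^ n ≡ b ^ n * c ^ n
^-distribʳ-* zero    b c = refl
^-distribʳ-* (suc n) b c = trans (cong (b * c *_) (^-distribʳ-* n b c)) (*-interchange b c (b ^ n) (c ^ n))

scale-^ : ∀ c → scale 2 (c ^_) ≗ (c ^_) ⋆ (c ^_)
scale-^ c n = begin
  2 ^ n * c ^ n        ≡⟨ ^-distribʳ-* n 2 c ⟨
  (2 * c) ^ n          ≡⟨ cong (λ d → (c + d) ^ n) (+-identityʳ c) ⟩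
  (c + c) ^ n          ≡⟨ ^-⋆ c c n ⟨
  ((c ^_) ⋆ (c ^_)) n  ∎

module _ (y : ℕ) .{{_ : NonZero y}} {α β δ : Seq} where

  private
    x = 1 + y
    E X : Seq
    E = 1 ^_
    X = x ^_

  -- Adding y to the second hypothesis and using the first gives X δ + y = x E δ; `scale 2` carries
  -- this over to the squares of X and E, as `excedance-identity` requires.
  functionalEquation :
    const 1 ⊞ α ≗ E ⋆ δ → const 1 ⊞ const x ⋆ α ≗ X ⋆ δ → β ≗ X ⋆ scale 2 δ →
    β ≗ δ ⊞ const x ⋆ (α ⋆ δ) ⊞ const x ⋆ (α ⋆ (α ⋆ β))
  functionalEquation α-E α-X β-X n = begin
    β n                                        ≡⟨ *-cancelˡ-≡ _ _ y (+-cancelˡ-≡ (w n) _ _ identity) ⟩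
    (δ ⊞ (const 1 ⊞ const y) ⋆ (α ⋆ δ) ⊞ (const 1 ⊞ const y) ⋆ (α ⋆ (α ⋆ β))) n
      ≡⟨ S.+-cong (S.+-congˡ {x = δ} (S.*-congʳ {x = α ⋆ δ} (const-+ 1 y))) (S.*-congʳ {x = α ⋆ (α ⋆ β)} (const-+ 1 y)) n ⟩
    (δ ⊞ const x ⋆ (α ⋆ δ) ⊞ const x ⋆ (α ⋆ (α ⋆ β))) n ∎
    where
    open SemiringSolver ⋆-commutativeSemiring

    w x′ : Seq
    w  = X ⋆ δ ⋆ (X ⋆ δ) ⋆ β
    -- The constant x is kept as a sum, the form in which the solver and `excedance-identity` can
    -- use that x exceeds y by 1.
    x′ = const 1 ⊞ const y

    α-X′ : const 1 ⊞ x′ ⋆ α ≗ X ⋆ δ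
    α-X′ = S.trans (S.+-congˡ {x = const 1} (S.*-congʳ {x = α} (const-+ 1 y))) α-X

    unscaled : X ⋆ δ ⊞ const y ≗ x′ ⋆ (E ⋆ δ)
    unscaled = S.trans (S.+-congʳ {x = const y} (S.sym α-X′))
      (S.trans (solve 2 (λ y α → (con 1 :+ (con 1 :+ y) :* α) :+ y := (con 1 :+ y) :* (con 1 :+ α)) (λ _ → refl) (const y) α)
               (S.*-congˡ {x = x′} α-E))

    scale-exp : ∀ c → scale 2 ((c ^_) ⋆ δ) ≗ (c ^_) ⋆ (c ^_) ⋆ scale 2 δ
    scale-exp c = S.trans (scale-⋆ 2 (c ^_) δ) (S.*-congʳ {x = scale 2 δ} (scale-^ c))

    -- Replacing t by 2t leaves constants alone and squares the exponentials.
    scaled : X ⋆ X ⋆ scale 2 δ ⊞ const y ≗ x′ ⋆ (E ⋆ E ⋆ scale 2 δ)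
    scaled n = begin
      (X ⋆ X ⋆ scale 2 δ) n + const y n          ≡⟨ cong₂ _+_ (scale-exp x n) (scale-const 2 y n) ⟨
      2 ^ n * (X ⋆ δ) n + 2 ^ n * const y n      ≡⟨ *-distribˡ-+ (2 ^ n) ((X ⋆ δ) n) _ ⟨
      2 ^ n * ((X ⋆ δ) n + const y n)            ≡⟨ cong (2 ^ n *_) (unscaled n) ⟩
      scale 2 (x′ ⋆ (E ⋆ δ)) n                   ≡⟨ scale-⋆ 2 x′ (E ⋆ δ) n ⟩
      (scale 2 x′ ⋆ scale 2 (E ⋆ δ)) n
        ≡⟨ ⋆-cong (λ m → trans (*-distribˡ-+ (2 ^ m) (const 1 m) _) (cong₂ _+_ (scale-const 2 1 m) (scale-const 2 y m)))
                  (scale-exp 1) n ⟩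
      (x′ ⋆ (E ⋆ E ⋆ scale 2 δ)) n ∎

    identity : w n + y * β n ≡ w n + y * (δ ⊞ x′ ⋆ (α ⋆ δ) ⊞ x′ ⋆ (α ⋆ (α ⋆ β))) n
    identity = begin
      w n + y * β n            ≡⟨ cong (w n +_) (const-⋆ y β n) ⟨
      w n + (const y ⋆ β) n    ≡⟨ excedance-identity ⋆-commutativeSemiring {δ₂ = scale 2 δ} α-E α-X′ β-X scaled n ⟩
      w n + (const y ⋆ (δ ⊞ x′ ⋆ (α ⋆ δ) ⊞ x′ ⋆ (α ⋆ (α ⋆ β)))) n
        ≡⟨ cong (w n +_) (const-⋆ y _ n) ⟩
      w n + y * (δ ⊞ x′ ⋆ (α ⋆ δ) ⊞ x′ ⋆ (α ⋆ (α ⋆ β))) n ∎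

sumOver-upTo-∷ʳ : ∀ n f → sumOver (upTo (suc n)) f ≡ sumOver (upTo n) f + f n
sumOver-upTo-∷ʳ n f = trans (cong (λ is → sumOver is f) (sym (upTo-∷ʳ n)))
  (trans (sumOver-++ (upTo n) (n ∷ []) f) (cong (sumOver (upTo n) f +_) (+-identityʳ (f n))))

⌊k+1/2⌋-even : ∀ k → ⌊ k * 2 + 1 /2⌋ ≡ k
⌊k+1/2⌋-even zero    = refl
⌊k+1/2⌋-even (suc k) = cong suc (⌊k+1/2⌋-even k)

⌊k+1/2⌋-odd : ∀ k → ⌊ suc (k * 2) + 1 /2⌋ ≡ suc k
⌊k+1/2⌋-odd zero    = refl
⌊k+1/2⌋-odd (suc k) = cong suc (⌊k+1/2⌋-odd k)

module _ (x : ℕ) (α δ : Seq) where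

  seriesTerm : ℕ → Seq
  seriesTerm k n = x ^ ⌊ k + 1 /2⌋ * (δ ⋆ α ⋆^ k) n

  module _ {β : Seq} (β-eq : β ≗ δ ⊞ const x ⋆ (α ⋆ δ) ⊞ const x ⋆ (α ⋆ (α ⋆ β))) where

    open SemiringSolver ⋆-commutativeSemiring

    -- One use of the equation for the factor β of the remainder produces the terms k = 2K and k =
    -- 2K + 1, with exponents K and K + 1 of x, and a new remainder with one more x and two more α.
    unroll : ∀ K n → β n ≡ (Σ[ k ∈ upTo (K * 2) ] seriesTerm k n) + x ^ K * (β ⋆ α ⋆^ (K * 2)) n
    unroll zero    n = sym (trans (*-identityˡ _) (trans (⋆-comm β (const 1) n) (⋆-identityˡ β n)))
    unroll (suc K) n = begin
      β n
        ≡⟨ unroll K n ⟩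
      partial + x ^ K * (β ⋆ p) n
        ≡⟨ cong (λ r → partial + x ^ K * r) (S.*-congʳ {x = p} β-eq n) ⟩
      partial + x ^ K * ((δ ⊞ const x ⋆ (α ⋆ δ) ⊞ const x ⋆ (α ⋆ (α ⋆ β))) ⋆ p) n
        ≡⟨ cong (λ r → partial + x ^ K * r) (solve 5 (λ δ x α β p →
             (δ :+ x :* (α :* δ) :+ x :* (α :* (α :* β))) :* p
             := δ :* p :+ x :* (δ :* (α :* p)) :+ x :* (β :* (α :* (α :* p))))
             (λ _ → refl) δ (const x) α β p n) ⟩
      partial + x ^ K * ((δ ⋆ p) n + (const x ⋆ (δ ⋆ (α ⋆ p))) n + (const x ⋆ (β ⋆ (α ⋆ (α ⋆ p)))) n)
        ≡⟨ cong₂ (λ a b → partial + x ^ K * ((δ ⋆ p) n + a + b)) (const-⋆ x (δ ⋆ (α ⋆ p)) n) (const-⋆ x (β ⋆ (α ⋆ (α ⋆ p))) n) ⟩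
      partial + x ^ K * ((δ ⋆ p) n + x * (δ ⋆ (α ⋆ p)) n + x * (β ⋆ (α ⋆ (α ⋆ p))) n)
        ≡⟨ distribute partial (x ^ K) x _ _ _ ⟩
      partial + x ^ K * (δ ⋆ p) n + x ^ suc K * (δ ⋆ (α ⋆ p)) n + x ^ suc K * (β ⋆ (α ⋆ (α ⋆ p))) n
        ≡⟨ cong₂ (λ i j → partial + x ^ i * (δ ⋆ p) n + x ^ j * (δ ⋆ (α ⋆ p)) n + x ^ suc K * (β ⋆ (α ⋆ (α ⋆ p))) n)
             (⌊k+1/2⌋-even K) (⌊k+1/2⌋-odd K) ⟨
      partial + seriesTerm (K * 2) n + seriesTerm (suc (K * 2)) n + x ^ suc K * (β ⋆ (α ⋆ (α ⋆ p))) n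
        ≡⟨ cong (_+ x ^ suc K * (β ⋆ (α ⋆ (α ⋆ p))) n)
             (trans (sumOver-upTo-∷ʳ (suc (K * 2)) term) (cong (_+ term (suc (K * 2))) (sumOver-upTo-∷ʳ (K * 2) term))) ⟨
      (Σ[ k ∈ upTo (suc K * 2) ] seriesTerm k n) + x ^ suc K * (β ⋆ α ⋆^ (suc K * 2)) n ∎
      where
      p : Seq
      p = α ⋆^ (K * 2)

      term : ℕ → ℕ
      term k = seriesTerm k n

      partial : ℕ
      partial = Σ[ k ∈ upTo (K * 2) ] seriesTerm k n

      distribute : ∀ s q x a b c → s + q * (a + x * b + x * c) ≡ s + q * a + x * q * b + x * q * c
      distribute = solve-∀

    -- Since α has no constant term, the remainder after n + 1 rounds has order at least 2 (n + 1),
    -- which exceeds n.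
    series : α 0 ≡ 0 → ∀ n → β n ≡ Σ[ k ∈ upTo (suc n * 2) ] seriesTerm k n
    series α0≡0 n = begin
      β n
        ≡⟨ unroll (suc n) n ⟩
      (Σ[ k ∈ upTo (suc n * 2) ] seriesTerm k n) + x ^ suc n * (β ⋆ α ⋆^ (suc n * 2)) n
        ≡⟨ cong (λ r → (Σ[ k ∈ upTo (suc n * 2) ] seriesTerm k n) + x ^ suc n * r)
             (⋆^-⋆-vanishes {α} {β} {suc n * 2} α0≡0 (m≤m*n (suc n) 2)) ⟩
      (Σ[ k ∈ upTo (suc n * 2) ] seriesTerm k n) + x ^ suc n * 0
        ≡⟨ trans (cong ((Σ[ k ∈ upTo (suc n * 2) ] seriesTerm k n) +_) (*-zeroʳ (x ^ suc n))) (+-identityʳ _) ⟩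
      (Σ[ k ∈ upTo (suc n * 2) ] seriesTerm k n) ∎

  seriesTerm-vanishes : α 0 ≡ 0 → ∀ {k n} → n < k → seriesTerm k n ≡ 0
  seriesTerm-vanishes α0≡0 {k} {n} n<k =
    trans (cong (x ^ ⌊ k + 1 /2⌋ *_) (⋆^-⋆-vanishes {α} {δ} {k} α0≡0 n<k)) (*-zeroʳ (x ^ ⌊ k + 1 /2⌋))

-- Sums over all indices

sumOver-allFin : (f : Fin n → ℕ) → sumOver (allFin n) f ≡ sum (List.tabulate f)
sumOver-allFin f = cong sum (map-tabulate (λ i → i) f)

sumOver-allFin-suc : (f : Fin (suc n) → ℕ) →
                     sumOver (allFin (suc n)) f ≡ f zero + sumOver (allFin n) (f ∘ suc)
sumOver-allFin-suc f = trans (sumOver-allFin f) (cong (f zero +_) (sym (sumOver-allFin (f ∘ suc))))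

sumOver-allFin-last : (f : Fin (suc n) → ℕ) →
                      sumOver (allFin (suc n)) f ≡ sumOver (allFin n) (f ∘ inject₁) + f (fromℕ n)
sumOver-allFin-last {zero}  f = +-identityʳ (f zero)
sumOver-allFin-last {suc n} f = begin
  sumOver (allFin (2 + n)) f
    ≡⟨ sumOver-allFin-suc f ⟩
  f zero + sumOver (allFin (suc n)) (f ∘ suc)
    ≡⟨ cong (f zero +_) (sumOver-allFin-last (f ∘ suc)) ⟩
  f zero + (sumOver (allFin n) (f ∘ inject₁ ∘ suc) + f (fromℕ (suc n)))
    ≡⟨ +-assoc (f zero) _ _ ⟨
  f zero + sumOver (allFin n) (f ∘ inject₁ ∘ suc) + f (fromℕ (suc n))
    ≡⟨ cong (_+ f (fromℕ (suc n))) (sumOver-allFin-suc (f ∘ inject₁)) ⟨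
  sumOver (allFin (suc n)) (f ∘ inject₁) + f (fromℕ (suc n)) ∎

-- Permutations

-- By the pigeonhole principle: punching a missed value out of the range would inject `Fin (suc n)`
-- into `Fin n`. Hence injectivity alone decides membership in `permutations`.
injective⇒strictlySurjective : {f : Fin n → Fin n} → Injective _≡_ _≡_ f → StrictlySurjective _≡_ f
injective⇒strictlySurjective {suc n} {f} f-inj j with Fin.any? (λ i → f i Fin.≟ j)
... | yes hit = hit
... | no ¬hit = contradiction
  (Fin.injective⇒≤ {f = λ i → punchOut (missed i)} (f-inj ∘ Fin.punchOut-injective (missed _) (missed _)))
  1+n≰n
  where
  missed : ∀ i → j ≢ f i
  missed i j≡fi = ¬hit (i , sym j≡fi)

∈-vectors : (is : List I) → (∀ i → i ∈ is) → ∀ {k} (v : Vec I k) → v ∈ vectors is k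
∈-vectors is all []      = here refl
∈-vectors is all (i ∷ v) = ∈-cartesianProductWith⁺ _∷_ (all i) (∈-vectors is all v)

vectors-unique : {is : List I} → Unique is → ∀ k → Unique (vectors is k)
vectors-unique is! zero    = All.[] AllPairs.∷ AllPairs.[]
vectors-unique is! (suc k) = Unique.cartesianProductWith⁺ _∷_ Vec.∷-injective is! (vectors-unique is! k)

permutations-unique : ∀ n → Unique (permutations n)
permutations-unique n = Unique.filter⁺ isPermutation? (vectors-unique (Unique.allFin⁺ n) n)

∈-permutations⁺ : {u : Vec (Fin n) n} → Injective _≡_ _≡_ (lookup u) → u ∈ permutations n
∈-permutations⁺ {n} {u} u-inj = ∈-filter⁺ isPermutation? (∈-vectors (allFin n) ∈-allFin u)
  ((λ {i} {j} → u-inj {i} {j}) , strictlySurjective⇒surjective (injective⇒strictlySurjective u-inj))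

∈-permutations⁻ : {u : Vec (Fin n) n} → u ∈ permutations n → Injective _≡_ _≡_ (lookup u)
∈-permutations⁻ {n} u∈ {i} {j} = proj₁ (proj₂ (∈-filter⁻ isPermutation? {xs = vectors (allFin n) n} u∈)) {i} {j}

module _ (φ : Vec (Fin n) n → Fin (suc n) → Vec (Fin (suc n)) (suc n))
         (φ-injective : Injective _≡_ _≡_ (uncurry φ))
         (φ-permutation : ∀ {u} i → Injective _≡_ _≡_ (lookup u) → Injective _≡_ _≡_ (lookup (φ u i)))
         (φ-surjective : ∀ {v} → Injective _≡_ _≡_ (lookup v) →
                         ∃[ u ] ∃[ i ] Injective _≡_ _≡_ (lookup u) × v ≡ φ u i)
         where

  -- The common frame of the insertion into cycles and the insertion into words: both identify a
  -- permutation of n + 1 letters with a permutation of n letters and one of n + 1 places.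
  sumOver-permutations-suc : (f : Vec (Fin (suc n)) (suc n) → ℕ) →
    sumOver (permutations (suc n)) f ≡ Σ[ u ∈ permutations n ] Σ[ i ∈ allFin (suc n) ] f (φ u i)
  sumOver-permutations-suc f = begin
    sumOver (permutations (suc n)) f
      ≡⟨ sumOver-reindex (uncurry φ) φ-injective
           (Unique.cartesianProduct⁺ (permutations-unique n) (Unique.allFin⁺ (suc n)))
           (permutations-unique (suc n)) to from f ⟩
    sumOver (cartesianProduct (permutations n) (allFin (suc n))) (f ∘ uncurry φ)
      ≡⟨ sumOver-cartesianProductWith _,_ (permutations n) (allFin (suc n)) _ ⟩
    (Σ[ u ∈ permutations n ] Σ[ i ∈ allFin (suc n) ] f (φ u i)) ∎
    where
    to : ∀ {ui} → ui ∈ cartesianProduct (permutations n) (allFin (suc n)) → uncurry φ ui ∈ permutations (suc n)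
    to {u , i} ui∈ = ∈-permutations⁺ (φ-permutation i
      (∈-permutations⁻ (proj₁ (∈-cartesianProduct⁻ (permutations n) (allFin (suc n)) ui∈))))

    from : ∀ {v} → v ∈ permutations (suc n) →
           ∃[ ui ] ui ∈ cartesianProduct (permutations n) (allFin (suc n)) × v ≡ uncurry φ ui
    from v∈ = let (u , i , u-inj , v≡) = φ-surjective (∈-permutations⁻ v∈)
              in (u , i) , ∈-cartesianProduct⁺ (∈-permutations⁺ u-inj) (∈-allFin i) , v≡

lookup-injective : {u v : Vec I n} → lookup u ≗ lookup v → u ≡ v
lookup-injective {u = u} {v} u≗v =
  trans (sym (Vec.tabulate∘lookup u)) (trans (Vec.tabulate-cong u≗v) (Vec.tabulate∘lookup v))

-- Insertion of a new largest letter into the cycles of a permutation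

transpose-ˡ : (i j : Fin n) → transpose i j i ≡ j
transpose-ˡ i j rewrite dec-true (i Fin.≟ i) refl = refl

transpose-ʳ : (i j : Fin n) → transpose i j j ≡ i
transpose-ʳ i j with j Fin.≟ i
... | yes j≡i = j≡i
... | no  _   rewrite dec-true (j Fin.≟ j) refl = refl

transpose-≢ : {i j k : Fin n} → k ≢ i → k ≢ j → transpose i j k ≡ k
transpose-≢ {i = i} {j} {k} k≢i k≢j rewrite dec-false (k Fin.≟ i) k≢i | dec-false (k Fin.≟ j) k≢j = refl

transpose-injective : (i j : Fin n) → Injective _≡_ _≡_ (transpose i j)
transpose-injective i j eq =
  trans (sym (transpose-inverse j i)) (trans (cong (transpose j i) eq) (transpose-inverse j i))

fixLast : (Fin n → Fin n) → Fin (suc n) → Fin (suc n)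
fixLast f k with view k
... | ‵fromℕ     = fromℕ _
... | ‵inject₁ j = inject₁ (f j)

fixLast-fromℕ : (f : Fin n → Fin n) → fixLast f (fromℕ n) ≡ fromℕ n
fixLast-fromℕ {n} f rewrite view-fromℕ n = refl

fixLast-inject₁ : (f : Fin n → Fin n) (j : Fin n) → fixLast f (inject₁ j) ≡ inject₁ (f j)
fixLast-inject₁ f j rewrite view-inject₁ j = refl

fixLast≡fromℕ : (f : Fin n → Fin n) {k : Fin (suc n)} → fixLast f k ≡ fromℕ n → k ≡ fromℕ n
fixLast≡fromℕ f {k} eq with view k
... | ‵fromℕ     = refl
... | ‵inject₁ j = contradiction (sym eq) Fin.fromℕ≢inject₁

fixLast-injective : {f : Fin n → Fin n} → Injective _≡_ _≡_ f → Injective _≡_ _≡_ (fixLast f)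
fixLast-injective f-inj {k} {l} eq with view k | view l
... | ‵fromℕ     | ‵fromℕ     = refl
... | ‵fromℕ     | ‵inject₁ _ = contradiction eq Fin.fromℕ≢inject₁
... | ‵inject₁ _ | ‵fromℕ     = contradiction (sym eq) Fin.fromℕ≢inject₁
... | ‵inject₁ _ | ‵inject₁ _ = cong inject₁ (f-inj (Fin.inject₁-injective eq))

-- Composition with the transposition places the new letter directly after i in its cycle, as i ↦ n
-- ↦ u(i). If i is itself the new index, the transposition is trivial and the letter is a fixed
-- point.
insertMax : Vec (Fin n) n → Fin (suc n) → Vec (Fin (suc n)) (suc n)
insertMax {n} u i = tabulate (fixLast (lookup u) ∘ transpose i (fromℕ n))

module _ (u : Vec (Fin n) n) where

  lookup-insertMax : ∀ i k → lookup (insertMax u i) k ≡ fixLast (lookup u) (transpose i (fromℕ n) k)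
  lookup-insertMax i k = Vec.lookup∘tabulate (fixLast (lookup u) ∘ transpose i (fromℕ n)) k

  lookup-insertMax-self : ∀ i → lookup (insertMax u i) i ≡ fromℕ n
  lookup-insertMax-self i = trans (lookup-insertMax i i)
    (trans (cong (fixLast (lookup u)) (transpose-ˡ i (fromℕ n))) (fixLast-fromℕ (lookup u)))

  lookup-insertMax-last : ∀ j → lookup (insertMax u (inject₁ j)) (fromℕ n) ≡ inject₁ (lookup u j)
  lookup-insertMax-last j = trans (lookup-insertMax (inject₁ j) (fromℕ n))
    (trans (cong (fixLast (lookup u)) (transpose-ʳ (inject₁ j) (fromℕ n))) (fixLast-inject₁ (lookup u) j))

  lookup-insertMax-other : ∀ i k → inject₁ k ≢ i → lookup (insertMax u i) (inject₁ k) ≡ inject₁ (lookup u k)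
  lookup-insertMax-other i k k≢i = trans (lookup-insertMax i (inject₁ k))
    (trans (cong (fixLast (lookup u)) (transpose-≢ k≢i (Fin.fromℕ≢inject₁ ∘ sym))) (fixLast-inject₁ (lookup u) k))

  lookup-insertMax≡fromℕ : ∀ i {k} → lookup (insertMax u i) k ≡ fromℕ n → k ≡ i
  lookup-insertMax≡fromℕ i {k} eq = transpose-injective i (fromℕ n)
    (trans (fixLast≡fromℕ (lookup u) (trans (sym (lookup-insertMax i k)) eq)) (sym (transpose-ˡ i (fromℕ n))))

-- The place i is recovered as the preimage of the largest letter, and u by undoing the
-- transposition.
insertMax-injective : Injective _≡_ _≡_ (uncurry (insertMax {n}))
insertMax-injective {n} {u , i} {v , j} eq
  with refl ← lookup-insertMax≡fromℕ v j {i} (trans (cong (λ w → lookup w i) (sym eq)) (lookup-insertMax-self u i))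
  = cong (_, i) (lookup-injective λ k → Fin.inject₁-injective (begin
      inject₁ (lookup u k)                      ≡⟨ fixLast-inject₁ (lookup u) k ⟨
      fixLast (lookup u) (inject₁ k)            ≡⟨ untranspose u k ⟩
      lookup (insertMax u i) (back k)           ≡⟨ cong (λ w → lookup w (back k)) eq ⟩
      lookup (insertMax v i) (back k)           ≡⟨ untranspose v k ⟨
      fixLast (lookup v) (inject₁ k)            ≡⟨ fixLast-inject₁ (lookup v) k ⟩
      inject₁ (lookup v k)                      ∎))
  where
  back : Fin n → Fin (suc n)
  back k = transpose (fromℕ n) i (inject₁ k)

  untranspose : ∀ u k → fixLast (lookup u) (inject₁ k) ≡ lookup (insertMax u i) (back k)
  untranspose u k = sym (trans (lookup-insertMax u i (back k))
    (cong (fixLast (lookup u)) (transpose-inverse i (fromℕ n) {inject₁ k})))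

insertMax-permutation : {u : Vec (Fin n) n} (i : Fin (suc n)) →
  Injective _≡_ _≡_ (lookup u) → Injective _≡_ _≡_ (lookup (insertMax u i))
insertMax-permutation {n} {u} i u-inj {k} {l} eq = transpose-injective i (fromℕ n)
  (fixLast-injective u-inj (trans (sym (lookup-insertMax u i k)) (trans eq (lookup-insertMax u i l))))

insertMax-surjective : {v : Vec (Fin (suc n)) (suc n)} → Injective _≡_ _≡_ (lookup v) →
  ∃[ u ] ∃[ i ] Injective _≡_ _≡_ (lookup u) × v ≡ insertMax u i
insertMax-surjective {n} {v} v-inj
  with i , vi≡ ← injective⇒strictlySurjective v-inj (fromℕ n)
  = tabulate lower , i , u-inj , lookup-injective v≗
  where
  -- With i the preimage of the largest letter, undoing the transposition gives a permutation that
  -- fixes this letter and so restricts to the others.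
  ρ : Fin (suc n) → Fin (suc n)
  ρ k = lookup v (transpose (fromℕ n) i k)

  ρ-inj : Injective _≡_ _≡_ ρ
  ρ-inj = transpose-injective (fromℕ n) i ∘ v-inj

  ρ-last : ρ (fromℕ n) ≡ fromℕ n
  ρ-last = trans (cong (lookup v) (transpose-ˡ (fromℕ n) i)) vi≡

  ρ-inject₁ : ∀ j → ∃[ k ] ρ (inject₁ j) ≡ inject₁ k
  ρ-inject₁ j with ρ (inject₁ j) in eq
  ... | r with view r
  ...   | ‵fromℕ     = contradiction (ρ-inj {fromℕ n} {inject₁ j} (trans ρ-last (sym eq))) Fin.fromℕ≢inject₁
  ...   | ‵inject₁ k = k , refl

  lower : Fin n → Fin n
  lower = proj₁ ∘ ρ-inject₁

  lookup-lower : ∀ j → inject₁ (lookup (tabulate lower) j) ≡ ρ (inject₁ j)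
  lookup-lower j = trans (cong inject₁ (Vec.lookup∘tabulate lower j)) (sym (proj₂ (ρ-inject₁ j)))

  u-inj : Injective _≡_ _≡_ (lookup (tabulate lower))
  u-inj {j} {k} eq = Fin.inject₁-injective (ρ-inj
    (trans (sym (lookup-lower j)) (trans (cong inject₁ eq) (lookup-lower k))))

  fixLast≗ρ : ∀ k → fixLast (lookup (tabulate lower)) k ≡ ρ k
  fixLast≗ρ k with view k
  ... | ‵fromℕ     = sym ρ-last
  ... | ‵inject₁ j = lookup-lower j

  v≗ : lookup v ≗ lookup (insertMax (tabulate lower) i)
  v≗ k = begin
    lookup v k                               ≡⟨ cong (lookup v) (transpose-inverse (fromℕ n) i) ⟨
    ρ (transpose i (fromℕ n) k)              ≡⟨ fixLast≗ρ (transpose i (fromℕ n) k) ⟨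
    fixLast (lookup (tabulate lower)) (transpose i (fromℕ n) k)
                                             ≡⟨ lookup-insertMax (tabulate lower) i k ⟨
    lookup (insertMax (tabulate lower) i) k  ∎

-- Insertion of a new smallest letter into the one-line notation

insertMin : Vec (Fin n) n → Fin (suc n) → Vec (Fin (suc n)) (suc n)
insertMin u i = insertAt (Vec.map suc u) i zero

module _ (u : Vec (Fin n) n) where

  lookup-insertMin-punchIn : ∀ i k → lookup (insertMin u i) (punchIn i k) ≡ suc (lookup u k)
  lookup-insertMin-punchIn i k = trans (Vec.insertAt-punchIn _ i zero k) (Vec.lookup-map k suc u)

data PunchView (i : Fin (suc n)) : Fin (suc n) → Set where
  here  : PunchView i i
  other : ∀ k → PunchView i (punchIn i k)

punchView : (i k : Fin (suc n)) → PunchView i k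
punchView i k with i Fin.≟ k
... | yes refl = here
... | no  i≢k  = subst (PunchView i) (Fin.punchIn-punchOut i≢k) (other (punchOut i≢k))

insertMin-injective : Injective _≡_ _≡_ (uncurry (insertMin {n}))
insertMin-injective {n} {u , i} {v , j} eq with punchView j i
... | here    = cong (_, i) (lookup-injective λ k → Fin.suc-injective
  (trans (sym (lookup-insertMin-punchIn u i k)) (trans (cong (λ w → lookup w (punchIn i k)) eq) (lookup-insertMin-punchIn v i k))))
... | other k with () ← trans (sym (Vec.insertAt-lookup (Vec.map suc u) i zero))
                              (trans (cong (λ w → lookup w i) eq) (lookup-insertMin-punchIn v j k))

insertMin-permutation : {u : Vec (Fin n) n} (i : Fin (suc n)) →
  Injective _≡_ _≡_ (lookup u) → Injective _≡_ _≡_ (lookup (insertMin u i))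
insertMin-permutation {u = u} i u-inj {k} {l} eq with punchView i k | punchView i l
... | here    | here    = refl
... | here    | other l with () ← trans (sym (Vec.insertAt-lookup (Vec.map suc u) i zero)) (trans eq (lookup-insertMin-punchIn u i l))
... | other k | here    with () ← trans (sym (Vec.insertAt-lookup (Vec.map suc u) i zero)) (trans (sym eq) (lookup-insertMin-punchIn u i k))
... | other k | other l = cong (punchIn i) (u-inj (Fin.suc-injective
  (trans (sym (lookup-insertMin-punchIn u i k)) (trans eq (lookup-insertMin-punchIn u i l)))))

insertMin-surjective : {v : Vec (Fin (suc n)) (suc n)} → Injective _≡_ _≡_ (lookup v) →
  ∃[ u ] ∃[ i ] Injective _≡_ _≡_ (lookup u) × v ≡ insertMin u i
insertMin-surjective {n} {v} v-inj
  with i , vi≡ ← injective⇒strictlySurjective v-inj zero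
  = tabulate lower , i , u-inj , lookup-injective v≗
  where
  v-punchIn : ∀ k → ∃[ l ] lookup v (punchIn i k) ≡ suc l
  v-punchIn k with lookup v (punchIn i k) in eq
  ... | zero  = contradiction (v-inj (trans eq (sym vi≡))) (Fin.punchInᵢ≢i i k)
  ... | suc l = l , refl

  lower : Fin n → Fin n
  lower = proj₁ ∘ v-punchIn

  lookup-lower : ∀ k → suc (lookup (tabulate lower) k) ≡ lookup v (punchIn i k)
  lookup-lower k = trans (cong suc (Vec.lookup∘tabulate lower k)) (sym (proj₂ (v-punchIn k)))

  u-inj : Injective _≡_ _≡_ (lookup (tabulate lower))
  u-inj {k} {l} eq = Fin.punchIn-injective i k l (v-inj
    (trans (sym (lookup-lower k)) (trans (cong suc eq) (lookup-lower l))))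

  v≗ : lookup v ≗ lookup (insertMin (tabulate lower) i)
  v≗ k with punchView i k
  ... | here    = trans vi≡ (sym (Vec.insertAt-lookup _ i zero))
  ... | other k = trans (sym (lookup-lower k)) (sym (lookup-insertMin-punchIn (tabulate lower) i k))

-- Counting indices by kind

data Kind : Set where
  exceeds fixed⁺ falls : Kind

-- The arguments are the numbers of indices of kind `exceeds`, `fixed⁺` and `falls`, in this order.
-- For words, `exceeds` and `falls` stand for descents and ascents.
Stat : Set
Stat = ℕ → ℕ → ℕ → ℕ

bump : Kind → Stat → Stat
bump exceeds f e p a = f (suc e) p a
bump fixed⁺  f e p a = f e (suc p) a
bump falls   f e p a = f e p (suc a)

-- The value of f at the numbers of indices of each kind

tally : (Fin n → Kind) → Stat → ℕ
tally {zero}  c f = f 0 0 0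
tally {suc n} c f = tally (c ∘ suc) (bump (c zero) f)

-- `tally c` is evaluation at a point that depends on c alone, so its linearity and its congruence
-- need no further induction.
tally-point : (c : Fin n → Kind) → ∃[ e ] ∃[ p ] ∃[ a ] ∀ f → tally c f ≡ f e p a
tally-point {zero}  c = 0 , 0 , 0 , λ f → refl
tally-point {suc n} c with c zero | tally-point (c ∘ suc)
... | exceeds | e , p , a , eq = suc e , p , a , λ f → eq (bump exceeds f)
... | fixed⁺  | e , p , a , eq = e , suc p , a , λ f → eq (bump fixed⁺ f)
... | falls   | e , p , a , eq = e , p , suc a , λ f → eq (bump falls f)

tally-cong : (c : Fin n → Kind) {f g : Stat} → (∀ e p a → f e p a ≡ g e p a) → tally c f ≡ tally c g
tally-cong c {f} {g} f≡g = let (e , p , a , eq) = tally-point c in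
  trans (eq f) (trans (f≡g e p a) (sym (eq g)))

tally-+ : (c : Fin n → Kind) (f g : Stat) → tally c (λ e p a → f e p a + g e p a) ≡ tally c f + tally c g
tally-+ c f g = let (e , p , a , eq) = tally-point c in trans (eq _) (sym (cong₂ _+_ (eq f) (eq g)))

tally-* : (c : Fin n → Kind) (b : ℕ) (f : Stat) → tally c (λ e p a → b * f e p a) ≡ b * tally c f
tally-* c b f = let (e , p , a , eq) = tally-point c in trans (eq _) (cong (b *_) (sym (eq f)))

tally-sumOver : (c : Fin n → Kind) (is : List I) (f : I → Stat) →
                tally c (λ e p a → Σ[ i ∈ is ] f i e p a) ≡ Σ[ i ∈ is ] tally c (f i)
tally-sumOver c is f = let (e , p , a , eq) = tally-point c in
  trans (eq _) (sumOver-cong is (λ i → sym (eq (f i))))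

tally-≗ : {c c′ : Fin n → Kind} → c ≗ c′ → (f : Stat) → tally c f ≡ tally c′ f
tally-≗ {zero}  c≗ f = refl
tally-≗ {suc n} {c} {c′} c≗ f =
  trans (tally-≗ (c≗ ∘ suc) (bump (c zero) f)) (cong (λ k → tally (c′ ∘ suc) (bump k f)) (c≗ zero))

bump-comm : ∀ k l f → bump k (bump l f) ≡ bump l (bump k f)
bump-comm exceeds exceeds f = refl
bump-comm exceeds fixed⁺  f = refl
bump-comm exceeds falls   f = refl
bump-comm fixed⁺  exceeds f = refl
bump-comm fixed⁺  fixed⁺  f = refl
bump-comm fixed⁺  falls   f = refl
bump-comm falls   exceeds f = refl
bump-comm falls   fixed⁺  f = refl
bump-comm falls   falls   f = refl

tally-remove : (c : Fin (suc n) → Kind) (i : Fin (suc n)) (f : Stat) →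
               tally c f ≡ tally (c ∘ punchIn i) (bump (c i) f)
tally-remove c zero f = refl
tally-remove {suc n} c (suc i) f = begin
  tally (c ∘ suc) (bump (c zero) f)
    ≡⟨ tally-remove (c ∘ suc) i (bump (c zero) f) ⟩
  tally (c ∘ suc ∘ punchIn i) (bump (c (suc i)) (bump (c zero) f))
    ≡⟨ cong (tally (c ∘ suc ∘ punchIn i)) (bump-comm (c (suc i)) (c zero) f) ⟩
  tally (c ∘ suc ∘ punchIn i) (bump (c zero) (bump (c (suc i)) f)) ∎

punchIn-fromℕ : (i : Fin n) → punchIn (fromℕ n) i ≡ inject₁ i
punchIn-fromℕ zero    = refl
punchIn-fromℕ (suc i) = cong suc (punchIn-fromℕ i)

tally-last : (c : Fin (suc n) → Kind) (f : Stat) → tally c f ≡ tally (c ∘ inject₁) (bump (c (fromℕ n)) f)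
tally-last {n} c f = trans (tally-remove c (fromℕ n) f)
  (tally-≗ (cong c ∘ punchIn-fromℕ) (bump (c (fromℕ n)) f))

-- Insertion after an index replaces that index, whatever its kind, by one index
-- of kind exceeds and one of kind falls.

insertionStep : Stat → Stat
insertionStep f e p a =
  e * f e p (suc a) + p * f (suc e) (pred p) (suc a) + a * f (suc e) p a

-- Accounting for one more index of kind k adds one place of insertion, that index itself; inserting
-- there gives the first summand.
bump-insertionStep : ∀ k f e p a →
  bump exceeds (bump falls f) e p a + insertionStep (bump k f) e p a ≡ bump k (insertionStep f) e p a
bump-insertionStep exceeds f e p a = rearrange (f (suc e) p (suc a)) _ _ _
  where
  rearrange : ∀ x y z w → x + (y + z + w) ≡ x + y + z + w
  rearrange = solve-∀
bump-insertionStep falls f e p a =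
  rearrange (f (suc e) p (suc a)) (e * f e p (2+ a)) (p * f (suc e) (pred p) (2+ a)) (a * f (suc e) p (suc a))
  where
  rearrange : ∀ x y z w → x + (y + z + w) ≡ y + z + (x + w)
  rearrange = solve-∀
bump-insertionStep fixed⁺ f e zero a = 
  rearrange (f (suc e) 0 (suc a)) (e * f e 1 (suc a)) (a * f (suc e) 1 a)
  where
  rearrange : ∀ x y w → x + (y + 0 + w) ≡ y + (x + 0) + w
  rearrange = solve-∀
bump-insertionStep fixed⁺ f e (suc p) a = 
  rearrange (f (suc e) (suc p) (suc a)) (e * f e (2+ p) (suc a)) (suc p * f (suc e) (suc p) (suc a)) (a * f (suc e) (2+ p) a)
  where
  rearrange : ∀ x y z w → x + (y + z + w) ≡ y + (x + z) + w
  rearrange = solve-∀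

-- Each index in turn is traded for one of kind `exceeds` and one of kind `falls`. Grouping the
-- indices by their own kind yields the coefficients e, p and a of `insertionStep`.
sum-tally-remove : (c : Fin (suc n) → Kind) (f : Stat) →
  (Σ[ i ∈ allFin (suc n) ] tally (c ∘ punchIn i) (bump exceeds (bump falls f))) ≡ tally c (insertionStep f)
sum-tally-remove {n} c f = begin
  sumOver (allFin (suc n)) (λ i → tally (c ∘ punchIn i) g)
    ≡⟨ sumOver-allFin-suc (λ i → tally (c ∘ punchIn i) g) ⟩
  tally (c ∘ suc) g + sumOver (allFin n) (λ i → tally (c ∘ punchIn (suc i)) g)
    ≡⟨ cong (tally (c ∘ suc) g +_) (rest n c) ⟩
  tally (c ∘ suc) g + tally (c ∘ suc) (insertionStep (bump (c zero) f))
    ≡⟨ tally-+ (c ∘ suc) g _ ⟨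
  tally (c ∘ suc) (λ e p a → g e p a + insertionStep (bump (c zero) f) e p a)
    ≡⟨ tally-cong (c ∘ suc) (bump-insertionStep (c zero) f) ⟩
  tally (c ∘ suc) (bump (c zero) (insertionStep f)) ∎
  where
  g : Stat
  g = bump exceeds (bump falls f)

  rest : ∀ n (c : Fin (suc n) → Kind) → sumOver (allFin n) (λ i → tally (c ∘ punchIn (suc i)) g) ≡
                 tally (c ∘ suc) (insertionStep (bump (c zero) f))
  rest zero    c = refl
  rest (suc n) c = trans
    (sumOver-cong (allFin (suc n)) λ i → cong (tally (c ∘ suc ∘ punchIn i))
      (trans (bump-comm (c zero) exceeds (bump falls f)) (cong (bump exceeds) (bump-comm (c zero) falls f))))
    (sum-tally-remove (c ∘ suc) (bump (c zero) f))

-- The kinds of the indices of a signed permutation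

Excedance PositiveFixed : ℤ → ℤ → Set
Excedance a b     = a ℤ.< b ⊎ (a ℤ.< 0ℤ × b ≡ a)
PositiveFixed a b = 0ℤ ℤ.< a × b ≡ a

excedance? : ∀ a b → Dec (Excedance a b)
excedance? a b = (a ℤ.<? b) ⊎-dec ((a ℤ.<? 0ℤ) ×-dec (b ℤ.≟ a))

positiveFixed? : ∀ a b → Dec (PositiveFixed a b)
positiveFixed? a b = (0ℤ ℤ.<? a) ×-dec (b ℤ.≟ a)

kindOf : ℤ → ℤ → Kind
kindOf a b = if does (excedance? a b) then exceeds else
             if does (positiveFixed? a b) then fixed⁺ else falls

kindOf-exceeds : ∀ {a b} → Excedance a b → kindOf a b ≡ exceeds
kindOf-exceeds {a} {b} exc rewrite dec-true (excedance? a b) exc = refl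

kindOf-fixed⁺ : ∀ {a b} → PositiveFixed a b → kindOf a b ≡ fixed⁺
kindOf-fixed⁺ {a} {b} fix@(0<a , b≡a)
  rewrite dec-false (excedance? a b) (λ { (inj₁ a<b) → ℤ.<-irrefl (sym b≡a) a<b ; (inj₂ (a<0 , _)) → ℤ.<-asym 0<a a<0 })
        | dec-true (positiveFixed? a b) fix = refl

kindOf-falls : ∀ {a b} → b ℤ.< a → kindOf a b ≡ falls
kindOf-falls {a} {b} b<a
  rewrite dec-false (excedance? a b) (λ { (inj₁ a<b) → ℤ.<-asym a<b b<a ; (inj₂ (_ , b≡a)) → ℤ.<-irrefl b≡a b<a })
        | dec-false (positiveFixed? a b) (λ (_ , b≡a) → ℤ.<-irrefl b≡a b<a) = refl

kind : SignedPermutation n → Fin n → Kind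
kind w i = kindOf (element w i) (image w i)

letter : Vec Sign n → Fin n → ℤ
letter ε i = lookup ε i ◃ suc (toℕ i)

lookup-∷ʳ-inject₁ : ∀ (v : Vec I n) x i → lookup (v ∷ʳ x) (inject₁ i) ≡ lookup v i
lookup-∷ʳ-inject₁ (y ∷ v) x zero    = refl
lookup-∷ʳ-inject₁ (y ∷ v) x (suc i) = lookup-∷ʳ-inject₁ v x i

lookup-∷ʳ-fromℕ : ∀ (v : Vec I n) x → lookup (v ∷ʳ x) (fromℕ n) ≡ x
lookup-∷ʳ-fromℕ []      x = refl
lookup-∷ʳ-fromℕ (y ∷ v) x = lookup-∷ʳ-fromℕ v x

module _ (ε : Vec Sign n) (s : Sign) where

  letter-inject₁ : ∀ i → letter (ε ∷ʳ s) (inject₁ i) ≡ letter ε i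
  letter-inject₁ i = cong₂ (λ t k → t ◃ suc k) (lookup-∷ʳ-inject₁ ε s i) (Fin.toℕ-inject₁ i)

  letter-fromℕ : letter (ε ∷ʳ s) (fromℕ n) ≡ s ◃ suc n
  letter-fromℕ = cong₂ (λ t k → t ◃ suc k) (lookup-∷ʳ-fromℕ ε s) (Fin.toℕ-fromℕ n)

◃-<-max : ∀ s {k n} → k < n → s ◃ suc k ℤ.< Sign.+ ◃ suc n
◃-<-max Sign.+ k<n = ℤ.+<+ (s<s k<n)
◃-<-max Sign.- k<n = ℤ.-<+

min-<-◃ : ∀ s {k n} → k < n → Sign.- ◃ suc n ℤ.< s ◃ suc k
min-<-◃ Sign.+ k<n = ℤ.-<+
min-<-◃ Sign.- k<n = ℤ.-<- k<n

fixedKind : Sign → Kind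
fixedKind Sign.+ = fixed⁺
fixedKind Sign.- = exceeds

kindOf-fixed : ∀ s k → kindOf (s ◃ suc k) (s ◃ suc k) ≡ fixedKind s
kindOf-fixed Sign.+ k = kindOf-fixed⁺ {Sign.+ ◃ suc k} {Sign.+ ◃ suc k} (ℤ.+<+ z<s , refl)
kindOf-fixed Sign.- k = kindOf-exceeds {Sign.- ◃ suc k} {Sign.- ◃ suc k} (inj₂ (ℤ.-<+ , refl))

module _ (ε : Vec Sign n) (u : Vec (Fin n) n) (s : Sign) where

  private
    grown : Fin (suc n) → SignedPermutation (suc n)
    grown i = ε ∷ʳ s , insertMax u i

  kind-insertMax-other : ∀ i k → inject₁ k ≢ i → kind (grown i) (inject₁ k) ≡ kind (ε , u) k
  kind-insertMax-other i k k≢i = cong₂ kindOf (letter-inject₁ ε s k)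
    (trans (cong (letter (ε ∷ʳ s)) (lookup-insertMax-other u i k k≢i)) (letter-inject₁ ε s (lookup u k)))

  kind-insertMax-fixed : kind (grown (fromℕ n)) (fromℕ n) ≡ fixedKind s
  kind-insertMax-fixed = trans
    (cong₂ kindOf (letter-fromℕ ε s) (trans (cong (letter (ε ∷ʳ s)) (lookup-insertMax-self u (fromℕ n))) (letter-fromℕ ε s)))
    (kindOf-fixed s n)

  kind-insertMax-before : ∀ j → kind (grown (inject₁ j)) (inject₁ j) ≡ kindOf (letter ε j) (s ◃ suc n)
  kind-insertMax-before j = cong₂ kindOf (letter-inject₁ ε s j)
    (trans (cong (letter (ε ∷ʳ s)) (lookup-insertMax-self u (inject₁ j))) (letter-fromℕ ε s))

  kind-insertMax-after : ∀ j → kind (grown (inject₁ j)) (fromℕ n) ≡ kindOf (s ◃ suc n) (letter ε (lookup u j))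
  kind-insertMax-after j = cong₂ kindOf (letter-fromℕ ε s)
    (trans (cong (letter (ε ∷ʳ s)) (lookup-insertMax-last u j)) (letter-inject₁ ε s (lookup u j)))

-- The new letter lies above all the others or below all of them, so of the two arrows through it
-- one rises and one falls, whatever the arrow they replace. Its sign decides only their order,
-- which the counts do not see.
bump-insertMax : ∀ (ε : Vec Sign n) (u : Vec (Fin n) n) s j f → let w = ε ∷ʳ s , insertMax u (inject₁ j) in
  bump (kind w (inject₁ j)) (bump (kind w (fromℕ n)) f) ≡ bump exceeds (bump falls f)
bump-insertMax ε u Sign.+ j f = cong₂ (λ k l → bump k (bump l f))
  (trans (kind-insertMax-before ε u Sign.+ j) (kindOf-exceeds {letter ε j} (inj₁ (◃-<-max (lookup ε j) (Fin.toℕ<n j)))))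
  (trans (kind-insertMax-after ε u Sign.+ j) (kindOf-falls (◃-<-max (lookup ε (lookup u j)) (Fin.toℕ<n (lookup u j)))))
bump-insertMax {n} ε u Sign.- j f = cong₂ (λ k l → bump k (bump l f))
  (trans (kind-insertMax-before ε u Sign.- j) (kindOf-falls {letter ε j} (min-<-◃ (lookup ε j) (Fin.toℕ<n j))))
  (trans (kind-insertMax-after ε u Sign.- j) (kindOf-exceeds {Sign.- ◃ suc n} (inj₁ (min-<-◃ (lookup ε (lookup u j)) (Fin.toℕ<n (lookup u j))))))

-- The last place makes the new letter a fixed point; each other place j breaks up the arrow out of
-- j.
sum-tally-insertMax : ∀ (ε : Vec Sign n) (u : Vec (Fin n) n) s f →
  (Σ[ i ∈ allFin (suc n) ] tally (kind (ε ∷ʳ s , insertMax u i)) f) ≡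
  tally (kind (ε , u)) (λ e p a → bump (fixedKind s) f e p a + insertionStep f e p a)
sum-tally-insertMax {n} ε u s f = begin
  sumOver (allFin (suc n)) inserted
    ≡⟨ sumOver-allFin-last inserted ⟩
  sumOver (allFin n) (inserted ∘ inject₁) + inserted (fromℕ n)
    ≡⟨ cong₂ _+_ (cyclic n ε u) fixed ⟩
  tally c (insertionStep f) + tally c (bump (fixedKind s) f)
    ≡⟨ +-comm (tally c (insertionStep f)) _ ⟩
  tally c (bump (fixedKind s) f) + tally c (insertionStep f)
    ≡⟨ tally-+ c (bump (fixedKind s) f) (insertionStep f) ⟨
  tally c (λ e p a → bump (fixedKind s) f e p a + insertionStep f e p a) ∎
  where
  c : Fin n → Kind
  c = kind (ε , u)

  inserted : Fin (suc n) → ℕ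
  inserted i = tally (kind (ε ∷ʳ s , insertMax u i)) f

  fixed : inserted (fromℕ n) ≡ tally c (bump (fixedKind s) f)
  fixed = begin
    tally (kind w) f                                           ≡⟨ tally-last (kind w) f ⟩
    tally (kind w ∘ inject₁) (bump (kind w (fromℕ n)) f)
      ≡⟨ tally-≗ (λ k → kind-insertMax-other ε u s (fromℕ n) k (Fin.fromℕ≢inject₁ ∘ sym)) (bump (kind w (fromℕ n)) f) ⟩
    tally c (bump (kind w (fromℕ n)) f)                        ≡⟨ cong (λ k → tally c (bump k f)) (kind-insertMax-fixed ε u s) ⟩
    tally c (bump (fixedKind s) f) ∎
    where w = ε ∷ʳ s , insertMax u (fromℕ n)

  cyclic : ∀ n (ε : Vec Sign n) (u : Vec (Fin n) n) →
    (Σ[ j ∈ allFin n ] tally (kind (ε ∷ʳ s , insertMax u (inject₁ j))) f) ≡ tally (kind (ε , u)) (insertionStep f)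
  cyclic zero    ε u = refl
  cyclic (suc n) ε u = trans (sumOver-cong (allFin (suc n)) eachCycle)
                             (sum-tally-remove (kind (ε , u)) f)
    where
    eachCycle : ∀ j → tally (kind (ε ∷ʳ s , insertMax u (inject₁ j))) f ≡
                 tally (kind (ε , u) ∘ punchIn j) (bump exceeds (bump falls f))
    eachCycle j = begin
      tally (kind w) f
        ≡⟨ tally-last (kind w) f ⟩
      tally (kind w ∘ inject₁) (bump (kind w (fromℕ (suc n))) f)
        ≡⟨ tally-remove (kind w ∘ inject₁) j (bump (kind w (fromℕ (suc n))) f) ⟩
      tally (kind w ∘ inject₁ ∘ punchIn j) (bump (kind w (inject₁ j)) (bump (kind w (fromℕ (suc n))) f))
        ≡⟨ cong (tally (kind w ∘ inject₁ ∘ punchIn j)) (bump-insertMax ε u s j f) ⟩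
      tally (kind w ∘ inject₁ ∘ punchIn j) (bump exceeds (bump falls f))
        ≡⟨ tally-≗ (λ k → kind-insertMax-other ε u s (inject₁ j) (punchIn j k)
             (Fin.punchInᵢ≢i j k ∘ Fin.inject₁-injective)) (bump exceeds (bump falls f)) ⟩
      tally (kind (ε , u) ∘ punchIn j) (bump exceeds (bump falls f)) ∎
      where w = ε ∷ʳ s , insertMax u (inject₁ j)

-- Sums over signed permutations

total : List Sign → ℕ → Stat → ℕ
total ss n f = Σ[ ε ∈ vectors ss n ] Σ[ u ∈ permutations n ] tally (kind (ε , u)) f

-- The transpose of the insertion of a signed letter: it acts on functions of the counts instead of
-- on their distribution.
growth : List Sign → Stat → Stat
growth ss f e p a = Σ[ s ∈ ss ] (bump (fixedKind s) f e p a + insertionStep f e p a)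

total-suc : ∀ ss n f → total ss (suc n) f ≡ total ss n (growth ss f)
total-suc ss n f = trans (sumOver-vectors-∷ʳ ss n _) (sumOver-cong (vectors ss n) λ ε → begin
  (Σ[ s ∈ ss ] Σ[ v ∈ permutations (suc n) ] tally (kind (ε ∷ʳ s , v)) f)
    ≡⟨ sumOver-cong ss (λ s → trans
         (sumOver-permutations-suc {n} insertMax insertMax-injective
           (λ {u} → insertMax-permutation {u = u}) insertMax-surjective (λ v → tally (kind (ε ∷ʳ s , v)) f))
         (sumOver-cong (permutations n) λ u → sum-tally-insertMax ε u s f)) ⟩
  (Σ[ s ∈ ss ] Σ[ u ∈ permutations n ] tally (kind (ε , u)) (step s))
    ≡⟨ sumOver-swap ss (permutations n) (λ s u → tally (kind (ε , u)) (step s)) ⟩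
  (Σ[ u ∈ permutations n ] Σ[ s ∈ ss ] tally (kind (ε , u)) (step s))
    ≡⟨ sumOver-cong (permutations n) (λ u → tally-sumOver (kind (ε , u)) ss step) ⟨
  (Σ[ u ∈ permutations n ] tally (kind (ε , u)) (growth ss f)) ∎)
  where
  step : Sign → Stat
  step s e p a = bump (fixedKind s) f e p a + insertionStep f e p a

total-zero : ∀ ss f → total ss 0 f ≡ f 0 0 0
total-zero ss f = trans (+-identityʳ _) (+-identityʳ _)

total-cong : ∀ ss n {f g} → (∀ e p a → f e p a ≡ g e p a) → total ss n f ≡ total ss n g
total-cong ss n f≡g = sumOver-cong (vectors ss n) λ ε → sumOver-cong (permutations n) λ u → tally-cong (kind (ε , u)) f≡g

total-+ : ∀ ss n f g → total ss n (λ e p a → f e p a + g e p a) ≡ total ss n f + total ss n g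
total-+ ss n f g = trans
  (sumOver-cong (vectors ss n) λ ε → trans
    (sumOver-cong (permutations n) λ u → tally-+ (kind (ε , u)) f g)
    (sumOver-+ (permutations n) _ _))
  (sumOver-+ (vectors ss n) _ _)

total-* : ∀ ss n c f → total ss n (λ e p a → c * f e p a) ≡ c * total ss n f
total-* ss n c f = trans
  (sumOver-cong (vectors ss n) λ ε → trans
    (sumOver-cong (permutations n) λ u → tally-* (kind (ε , u)) c f)
    (sumOver-* c (permutations n) _))
  (sumOver-* c (vectors ss n) _)

-- Descents

stepKind : Fin N → Fin N → Kind
stepKind a b = if does (b Fin.<? a) then exceeds else falls

descentKind : Vec (Fin N) (suc m) → Fin m → Kind
descentKind v i = stepKind (lookup v (inject₁ i)) (lookup v (suc i))

descentKind-map-suc : (v : Vec (Fin N) (suc m)) → descentKind (Vec.map suc v) ≗ descentKind v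
descentKind-map-suc v i = cong₂ stepKind (Vec.lookup-map (inject₁ i) suc v) (Vec.lookup-map (suc i) suc v)

-- A letter 0 inserted at a descent splits it into a descent and an ascent.  The
-- same happens at an ascent, and at the end one descent is added.

minInsertionTail minInsertionStep : Stat → Stat
minInsertionTail f e p a = e * f e p (suc a) + suc a * f (suc e) p a
minInsertionStep f e p a = f e p (suc a) + minInsertionTail f e p a

-- Stated for words over any `Fin N`, because dropping the first letter of a permutation does not
-- leave one. The place just after the first letter splits the first step; all later places belong
-- to the shorter word.
sum-insertMin-tail : (v : Vec (Fin N) (suc m)) (f : Stat) →
  (Σ[ i ∈ allFin (suc m) ] tally (descentKind (insertAt (Vec.map suc v) (suc i) zero)) f) ≡
  tally (descentKind v) (minInsertionTail f)
sum-insertMin-tail (a ∷ [])        f = refl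
sum-insertMin-tail {m = suc m} v₀@(a ∷ b ∷ v) f = begin
  sumOver (allFin (2 + m)) inserted
    ≡⟨ sumOver-allFin-suc inserted ⟩
  inserted zero + sumOver (allFin (suc m)) (inserted ∘ suc)
    ≡⟨ cong₂ _+_ (tally-≗ (descentKind-map-suc (b ∷ v)) (bump falls (bump exceeds f)))
                 (sum-insertMin-tail (b ∷ v) (bump k f)) ⟩
  tally c (bump falls (bump exceeds f)) + tally c (minInsertionTail (bump k f))
    ≡⟨ tally-+ c (bump falls (bump exceeds f)) (minInsertionTail (bump k f)) ⟨
  tally c (λ e p a → bump falls (bump exceeds f) e p a + minInsertionTail (bump k f) e p a)
    ≡⟨ tally-cong c bump-minInsertionTail ⟩
  tally c (bump k (minInsertionTail f)) ∎
  where
  k : Kind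
  k = stepKind a b

  c : Fin m → Kind
  c = descentKind (b ∷ v)

  inserted : Fin (2 + m) → ℕ
  inserted i = tally (descentKind (insertAt (Vec.map suc v₀) (suc i) zero)) f

  rearrange₁ : ∀ x e y → x + (e * x + y) ≡ suc e * x + y
  rearrange₁ = solve-∀

  rearrange₂ : ∀ x a y → x + (y + suc a * x) ≡ y + suc (suc a) * x
  rearrange₂ = solve-∀

  bump-minInsertionTail : ∀ e p a →
    bump falls (bump exceeds f) e p a + minInsertionTail (bump k f) e p a ≡ bump k (minInsertionTail f) e p a
  bump-minInsertionTail e p i with does (b Fin.<? a)
  ... | true  = rearrange₁ (f (suc e) p (suc i)) e (suc i * f (2+ e) p i)
  ... | false = rearrange₂ (f (suc e) p (suc i)) i (e * f e p (2+ i))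

-- In front of the word the letter 0 adds an ascent; this is the one place that `minInsertionTail`
-- leaves out.
sum-insertMin : (v : Vec (Fin (suc n)) (suc n)) (f : Stat) →
  (Σ[ i ∈ allFin (2 + n) ] tally (descentKind (insertMin v i)) f) ≡
  tally (descentKind v) (minInsertionStep f)
sum-insertMin {n} v@(a ∷ _) f = begin
  sumOver (allFin (2 + n)) inserted
    ≡⟨ sumOver-allFin-suc inserted ⟩
  inserted zero + sumOver (allFin (suc n)) (inserted ∘ suc)
    ≡⟨ cong₂ _+_ (tally-≗ (descentKind-map-suc v) (bump falls f)) (sum-insertMin-tail v f) ⟩
  tally (descentKind v) (bump falls f) + tally (descentKind v) (minInsertionTail f)
    ≡⟨ tally-+ (descentKind v) (bump falls f) (minInsertionTail f) ⟨
  tally (descentKind v) (minInsertionStep f) ∎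
  where
  inserted : Fin (2 + n) → ℕ
  inserted i = tally (descentKind (insertMin v i)) f

descentTotal : ℕ → Stat → ℕ
descentTotal n f = Σ[ u ∈ permutations (suc n) ] tally (descentKind u) f

descentTotal-suc : ∀ n f → descentTotal (suc n) f ≡ descentTotal n (minInsertionStep f)
descentTotal-suc n f = trans
  (sumOver-permutations-suc {suc n} insertMin insertMin-injective (λ {u} → insertMin-permutation {u = u})
    insertMin-surjective (λ u → tally (descentKind u) f))
  (sumOver-cong (permutations (suc n)) λ u → sum-insertMin u f)

descentTotal-cong : ∀ n {f g} → (∀ e p a → f e p a ≡ g e p a) → descentTotal n f ≡ descentTotal n g
descentTotal-cong n f≡g = sumOver-cong (permutations (suc n)) λ u → tally-cong (descentKind u) f≡g

-- Excedances and weak excedances against descents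

plus : List Sign
plus = Sign.+ ∷ []

-- The factor p makes the truncation of `pred` at 0 harmless.
pred-+-suc : ∀ p a (g : ℕ → ℕ) → p * g (pred p + suc a) ≡ p * g (p + a)
pred-+-suc zero    a g = refl
pred-+-suc (suc p) a g = cong (λ b → suc p * g b) (+-suc p a)

module _ (g : ℕ → ℕ → ℕ) where

  excedanceStep : ℕ → ℕ → ℕ
  excedanceStep e b = g e (suc b) + (e * g e (suc b) + b * g (suc e) b)

  -- Growth preserves the functions that see p and a only through p + a: an insertion after a fixed
  -- point and one after a falling index both raise e by one and keep p + a.
  growth-excedances : ∀ e p a → growth plus (λ e p a → g e (p + a)) e p a ≡ excedanceStep e (p + a)
  growth-excedances e p a = begin
    g e (suc (p + a)) + (e * g e (p + suc a) + p * g (suc e) (pred p + suc a) + a * g (suc e) (p + a)) + 0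
      ≡⟨ cong₂ (λ y z → g e (suc (p + a)) + (e * g e y + z + a * g (suc e) (p + a)) + 0)
               (+-suc p a) (pred-+-suc p a (g (suc e))) ⟩
    g e (suc (p + a)) + (e * g e (suc (p + a)) + p * g (suc e) (p + a) + a * g (suc e) (p + a)) + 0
      ≡⟨ rearrange (g e (suc (p + a))) e p a (g (suc e) (p + a)) ⟩
    excedanceStep e (p + a) ∎
    where
    rearrange : ∀ x e p a z → x + (e * x + p * z + a * z) + 0 ≡ x + (e * x + (p + a) * z)
    rearrange = solve-∀

  weakExcedanceStep : ℕ → ℕ → ℕ
  weakExcedanceStep w a = g (suc w) a + (w * g w (suc a) + a * g (suc w) a)

  -- Here fixed points join the excedances: an insertion after either keeps e + p and raises a by
  -- one.
  growth-weakExcedances : ∀ e p a → growth plus (λ e p a → g (e + p) a) e p a ≡ weakExcedanceStep (e + p) a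
  growth-weakExcedances e p a = begin
    g (e + suc p) a + (e * g (e + p) (suc a) + p * g (suc e + pred p) (suc a) + a * g (suc e + p) a) + 0
      ≡⟨ cong₂ (λ w z → g w a + (e * g (e + p) (suc a) + z + a * g (suc e + p) a) + 0) (+-suc e p) (suc-+-pred p) ⟩
    g (suc (e + p)) a + (e * g (e + p) (suc a) + p * g (e + p) (suc a) + a * g (suc (e + p)) a) + 0
      ≡⟨ rearrange (g (suc (e + p)) a) (g (e + p) (suc a)) e p a ⟩
    weakExcedanceStep (e + p) a ∎
    where
    suc-+-pred : ∀ p → p * g (suc e + pred p) (suc a) ≡ p * g (e + p) (suc a)
    suc-+-pred zero    = refl
    suc-+-pred (suc p) = cong (λ w → suc p * g w (suc a)) (sym (+-suc e p))

    rearrange : ∀ x z e p a → x + (e * z + p * z + a * x) + 0 ≡ x + ((e + p) * z + a * x)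
    rearrange = solve-∀

-- A word of n + 1 letters has n steps, so a ascents correspond to a + 1 indices that are not
-- excedances. After this shift `excedanceStep` and `minInsertionStep` coincide by computation.
excedances-descents : ∀ n (g : ℕ → ℕ → ℕ) →
  total plus (suc n) (λ e p a → g e (p + a)) ≡ descentTotal n (λ e p a → g e (suc a))
excedances-descents n g = trans (total-suc plus n _) (trans (total-cong plus n (growth-excedances g)) (go n))
  where
  go : ∀ n → total plus n (λ e p a → excedanceStep g e (p + a)) ≡ descentTotal n (λ e p a → g e (suc a))
  go zero    = total-zero plus (λ e p a → excedanceStep g e (p + a))
  go (suc n) = begin
    total plus (suc n) (λ e p a → excedanceStep g e (p + a))
      ≡⟨ excedances-descents n (excedanceStep g) ⟩
    descentTotal n (λ e p a → excedanceStep g e (suc a))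
      ≡⟨ descentTotal-suc n (λ e p a → g e (suc a)) ⟨
    descentTotal (suc n) (λ e p a → g e (suc a)) ∎

-- Now e descents correspond to e + 1 weak excedances. The two steps agree up to regrouping: the new
-- fixed point matches the insertion at the end of the word, and the additional weak excedance the
-- insertion at its front.
weakExcedances-descents : ∀ n (g : ℕ → ℕ → ℕ) →
  total plus (suc n) (λ e p a → g (e + p) a) ≡ descentTotal n (λ e p a → g (suc e) a)
weakExcedances-descents n g = trans (total-suc plus n _) (trans (total-cong plus n (growth-weakExcedances g)) (go n))
  where
  go : ∀ n → total plus n (λ e p a → weakExcedanceStep g (e + p) a) ≡ descentTotal n (λ e p a → g (suc e) a)
  go zero    = total-zero plus (λ e p a → weakExcedanceStep g (e + p) a)
  go (suc n) = begin
    total plus (suc n) (λ e p a → weakExcedanceStep g (e + p) a)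
      ≡⟨ weakExcedances-descents n (weakExcedanceStep g) ⟩
    descentTotal n (λ e p a → weakExcedanceStep g (suc e) a)
      ≡⟨ descentTotal-cong n (λ e p a → rearrange (g (2+ e) a) (g (suc e) (suc a)) e a) ⟩
    descentTotal n (minInsertionStep (λ e p a → g (suc e) a))
      ≡⟨ descentTotal-suc n (λ e p a → g (suc e) a) ⟨
    descentTotal (suc n) (λ e p a → g (suc e) a) ∎
    where
    rearrange : ∀ x z e a → x + (suc e * z + a * x) ≡ z + (e * z + suc a * x)
    rearrange = solve-∀

-- Weights on fixed points

-- binomialShift y f p is ∑ᵢ C(p,i) yⁱ f(p ∸ i).

binomialShift : ℕ → (ℕ → ℕ) → ℕ → ℕ
binomialShift y f zero    = f 0
binomialShift y f (suc p) = y * binomialShift y f p + binomialShift y (f ∘ suc) p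

module _ (y : ℕ) where

  private Q = binomialShift y

  binomialShift-cong : ∀ {f g} → f ≗ g → Q f ≗ Q g
  binomialShift-cong f≗g zero    = f≗g 0
  binomialShift-cong f≗g (suc p) =
    cong₂ (λ a b → y * a + b) (binomialShift-cong f≗g p) (binomialShift-cong (f≗g ∘ suc) p)

  binomialShift-+ : ∀ f g p → Q (λ p → f p + g p) p ≡ Q f p + Q g p
  binomialShift-+ f g zero    = refl
  binomialShift-+ f g (suc p) = trans
    (cong₂ (λ a b → y * a + b) (binomialShift-+ f g p) (binomialShift-+ (f ∘ suc) (g ∘ suc) p))
    (rearrange y (Q f p) _ _ _)
    where
    rearrange : ∀ y a b c d → y * (a + b) + (c + d) ≡ (y * a + c) + (y * b + d)
    rearrange = solve-∀

  binomialShift-* : ∀ c f p → Q (λ p → c * f p) p ≡ c * Q f p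
  binomialShift-* c f zero    = refl
  binomialShift-* c f (suc p) = trans
    (cong₂ (λ a b → y * a + b) (binomialShift-* c f p) (binomialShift-* c (f ∘ suc) p))
    (rearrange y c (Q f p) _)
    where
    rearrange : ∀ y c a b → y * (c * a) + c * b ≡ c * (y * a + b)
    rearrange = solve-∀

  -- Choosing i points and then one of the others amounts to choosing that one first: C(p,i) (p - i)
  -- = p C(p - 1,i).
  binomialShift-pred : ∀ f p → Q (λ p → p * f (pred p)) p ≡ p * Q f (pred p)
  binomialShift-pred f zero    = refl
  binomialShift-pred f (suc p) = begin
    y * Q (λ p → p * f (pred p)) p + Q (λ p → f p + p * f p) p
      ≡⟨ cong₂ (λ a b → y * a + b) (binomialShift-pred f p) (binomialShift-+ f (λ p → p * f p) p) ⟩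
    y * (p * Q f (pred p)) + (Q f p + Q (λ p → p * f p) p)
      ≡⟨ cong (λ b → y * (p * Q f (pred p)) + (Q f p + b))
           -- At p = 0 both functions are 0; the new form lets the induction hypothesis apply to
           -- `f ∘ suc`.
           (trans (binomialShift-cong {g = λ p → p * f (suc (pred p))} (λ { zero → refl ; (suc p) → refl }) p)
                  (binomialShift-pred (f ∘ suc) p)) ⟩
    y * (p * Q f (pred p)) + (Q f p + p * Q (f ∘ suc) (pred p))
      ≡⟨ collect p ⟩
    suc p * Q f p ∎
    where
    rearrange : ∀ y p a b → y * (suc p * a) + (y * a + b + suc p * b) ≡ suc (suc p) * (y * a + b)
    rearrange = solve-∀

    collect : ∀ p → y * (p * Q f (pred p)) + (Q f p + p * Q (f ∘ suc) (pred p)) ≡ suc p * Q f p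
    collect zero    = cong (_+ (f 0 + 0)) (*-zeroʳ y)
    collect (suc p) = rearrange y p (Q f p) _

  binomialShift-0^ : ∀ p → Q (0 ^_) p ≡ y ^ p
  binomialShift-0^ zero    = refl
  binomialShift-0^ (suc p) = trans (cong₂ (λ a b → y * a + b) (binomialShift-0^ p) (zeros p)) (+-identityʳ _)
    where
    zeros : ∀ p → Q (λ _ → 0) p ≡ 0
    zeros zero    = refl
    zeros (suc p) = cong₂ _+_ (trans (cong (y *_) (zeros p)) (*-zeroʳ y)) (zeros p)

shiftFixed : ℕ → Stat → Stat
shiftFixed y f e p a = binomialShift y (λ p → f e p a) p

insertionStep-shiftFixed : ∀ y f e p a →
  insertionStep (shiftFixed y f) e p a ≡ shiftFixed y (insertionStep f) e p a
insertionStep-shiftFixed y f e p a = sym (begin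
  Q (λ p → e * f e p (suc a) + p * f (suc e) (pred p) (suc a) + a * f (suc e) p a) p
    ≡⟨ binomialShift-+ y (λ p → e * f e p (suc a) + p * f (suc e) (pred p) (suc a)) _ p ⟩
  Q (λ p → e * f e p (suc a) + p * f (suc e) (pred p) (suc a)) p + Q (λ p → a * f (suc e) p a) p
    ≡⟨ cong (_+ Q (λ p → a * f (suc e) p a) p) (binomialShift-+ y (λ p → e * f e p (suc a)) _ p) ⟩
  Q (λ p → e * f e p (suc a)) p + Q (λ p → p * f (suc e) (pred p) (suc a)) p + Q (λ p → a * f (suc e) p a) p
    ≡⟨ cong₂ _+_ (cong₂ _+_ (binomialShift-* y e _ p) (binomialShift-pred y _ p)) (binomialShift-* y a _ p) ⟩
  insertionStep (shiftFixed y f) e p a ∎)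
  where Q = binomialShift y

-- A new fixed point is either chosen, with weight y, or left with the others. The two summands are
-- the Leibniz terms in which exp (y t) or the other factor is differentiated.
growth-shiftFixed : ∀ y f e p a →
  growth plus (shiftFixed y f) e p a ≡ y * shiftFixed y f e p a + shiftFixed y (growth plus f) e p a
growth-shiftFixed y f e p a = begin
  y * Q f + Q (bump fixed⁺ f) + insertionStep (shiftFixed y f) e p a + 0
    ≡⟨ +-identityʳ _ ⟩
  y * Q f + Q (bump fixed⁺ f) + insertionStep (shiftFixed y f) e p a
    ≡⟨ +-assoc (y * Q f) _ _ ⟩
  y * Q f + (Q (bump fixed⁺ f) + insertionStep (shiftFixed y f) e p a)
    ≡⟨ cong (λ b → y * Q f + (Q (bump fixed⁺ f) + b)) (insertionStep-shiftFixed y f e p a) ⟩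
  y * Q f + (Q (bump fixed⁺ f) + Q (insertionStep f))
    ≡⟨ cong (y * Q f +_) (binomialShift-+ y (λ p → f e (suc p) a) (λ p → insertionStep f e p a) p) ⟨
  y * Q f + binomialShift y (λ p → f e (suc p) a + insertionStep f e p a) p
    ≡⟨ cong (y * Q f +_) (binomialShift-cong y (λ p → sym (+-identityʳ (f e (suc p) a + insertionStep f e p a))) p) ⟩
  y * Q f + Q (growth plus f) ∎
  where
  Q : Stat → ℕ
  Q f = shiftFixed y f e p a

-- A set of fixed points is chosen, each with weight y.

total-shiftFixed : ∀ y f n → total plus n (shiftFixed y f) ≡ ((y ^_) ⋆ (λ m → total plus m f)) n
total-shiftFixed y f zero = begin
  total plus 0 (shiftFixed y f)   ≡⟨ total-zero plus (shiftFixed y f) ⟩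
  f 0 0 0                         ≡⟨ total-zero plus f ⟨
  total plus 0 f                  ≡⟨ *-identityˡ _ ⟨
  1 * total plus 0 f              ∎
total-shiftFixed y f (suc n) = begin
  total plus (suc n) (shiftFixed y f)
    ≡⟨ total-suc plus n (shiftFixed y f) ⟩
  total plus n (growth plus (shiftFixed y f))
    ≡⟨ total-cong plus n (growth-shiftFixed y f) ⟩
  total plus n (λ e p a → y * shiftFixed y f e p a + shiftFixed y (growth plus f) e p a)
    ≡⟨ total-+ plus n (λ e p a → y * shiftFixed y f e p a) (shiftFixed y (growth plus f)) ⟩
  total plus n (λ e p a → y * shiftFixed y f e p a) + total plus n (shiftFixed y (growth plus f))
    ≡⟨ cong₂ _+_ (trans (total-* plus n y (shiftFixed y f)) (cong (y *_) (total-shiftFixed y f n)))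
                 (total-shiftFixed y (growth plus f) n) ⟩
  y * (Y ⋆ t) n + (Y ⋆ (λ m → total plus m (growth plus f))) n
    ≡⟨ cong₂ _+_ (y*-⋆ n) (⋆-cong {Y} (λ _ → refl) (λ m → sym (total-suc plus m f)) n) ⟩
  (Y ⋆ t) (suc n) ∎
  where
  Y t : Seq
  Y = y ^_
  t m = total plus m f

  y*-⋆ : ∀ n → y * (Y ⋆ t) n ≡ ((Y ∘ suc) ⋆ t) n
  y*-⋆ n = begin
    y * (Y ⋆ t) n            ≡⟨ const-⋆ y (Y ⋆ t) n ⟨
    (const y ⋆ (Y ⋆ t)) n    ≡⟨ ⋆-assoc (const y) Y t n ⟨
    (const y ⋆ Y ⋆ t) n      ≡⟨ ⋆-cong (const-⋆ y Y) (λ _ → refl) n ⟩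
    ((Y ∘ suc) ⋆ t) n        ∎

-- From positive letters to both signs

-- signFixed f e p a is ∑ᵢ C(p,i) f(e + i, p ∸ i, a): of the p fixed points, i
-- become negative and hence B-excedances.

signFixed : Stat → Stat
signFixed f e zero    a = f e zero a
signFixed f e (suc p) a = signFixed (λ e p a → f e (suc p) a + f (suc e) p a) e p a

signFixed-cong : ∀ {f g : Stat} → (∀ e p a → f e p a ≡ g e p a) → ∀ e p a → signFixed f e p a ≡ signFixed g e p a
signFixed-cong f≡g e zero    a = f≡g e 0 a
signFixed-cong f≡g e (suc p) a = signFixed-cong (λ e p a → cong₂ _+_ (f≡g e (suc p) a) (f≡g (suc e) p a)) e p a

signFixed-+ : ∀ f g e p a → signFixed (λ e p a → f e p a + g e p a) e p a ≡ signFixed f e p a + signFixed g e p a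
signFixed-+ f g e zero    a = refl
signFixed-+ f g e (suc p) a = trans
  (signFixed-cong (λ e p a → rearrange (f e (suc p) a) (g e (suc p) a) _ _) e p a)
  (signFixed-+ (λ e p a → f e (suc p) a + f (suc e) p a) _ e p a)
  where
  rearrange : ∀ a b c d → (a + b) + (c + d) ≡ (a + c) + (b + d)
  rearrange = solve-∀

signFixed-* : ∀ c f e p a → signFixed (λ e p a → c * f e p a) e p a ≡ c * signFixed f e p a
signFixed-* c f e zero    a = refl
signFixed-* c f e (suc p) a = trans
  (signFixed-cong (λ e p a → sym (*-distribˡ-+ c (f e (suc p) a) _)) e p a)
  (signFixed-* c (λ e p a → f e (suc p) a + f (suc e) p a) e p a)

signFixed-shift : ∀ f e p a → signFixed (λ e p a → f (suc e) p (suc a)) e p a ≡ signFixed f (suc e) p (suc a)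
signFixed-shift f e zero    a = refl
signFixed-shift f e (suc p) a = signFixed-shift (λ e p a → f e (suc p) a + f (suc e) p a) e p a

-- An insertion after one of the p fixed points destroys it. That point had either sign before, and
-- both cases lead to the same counts, whence the factor 2.
signFixed-insertionStep : ∀ f e p a → let U = signFixed f in
  signFixed (insertionStep f) e p a ≡
  e * U e p (suc a) + 2 * (p * U (suc e) (pred p) (suc a)) + a * U (suc e) p a
signFixed-insertionStep f e zero    a = refl
signFixed-insertionStep f e (suc p) a = begin
  signFixed (insertionStep f) e (suc p) a
    ≡⟨ signFixed-cong split e p a ⟩
  signFixed (λ e p a → insertionStep g e p a + 2 * f (suc e) p (suc a)) e p a
    ≡⟨ signFixed-+ (insertionStep g) (λ e p a → 2 * f (suc e) p (suc a)) e p a ⟩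
  signFixed (insertionStep g) e p a + signFixed (λ e p a → 2 * f (suc e) p (suc a)) e p a
    ≡⟨ cong₂ _+_ (signFixed-insertionStep g e p a)
         (trans (signFixed-* 2 (λ e p a → f (suc e) p (suc a)) e p a) (cong (2 *_) (signFixed-shift f e p a))) ⟩
  e * V e p (suc a) + 2 * (p * V (suc e) (pred p) (suc a)) + a * V (suc e) p a + 2 * U (suc e) p (suc a)
    ≡⟨ collect p ⟩
  e * V e p (suc a) + 2 * (suc p * U (suc e) p (suc a)) + a * V (suc e) p a ∎
  where
  g U V : Stat
  g e p a = f e (suc p) a + f (suc e) p a
  U = signFixed f
  V = signFixed g

  split : ∀ e p a → insertionStep f e (suc p) a + insertionStep f (suc e) p a ≡
                    insertionStep g e p a + 2 * f (suc e) p (suc a)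
  split e zero    a = rearrange₀ e a (f e 1 (suc a)) (f (suc e) 0 (suc a)) (f (suc e) 1 a) (f (2+ e) 0 a)
    where
    rearrange₀ : ∀ e a x u y z → (e * x + 1 * u + a * y) + (suc e * u + 0 + a * z) ≡
                 (e * (x + u) + 0 + a * (y + z)) + 2 * u
    rearrange₀ = solve-∀
  split e (suc p) a = rearrange₁ e p a (f e (2+ p) (suc a)) (f (suc e) (suc p) (suc a)) (f (suc e) (2+ p) a)
                        (f (2+ e) p (suc a)) (f (2+ e) (suc p) a)
    where
    rearrange₁ : ∀ e p a x u y v z → (e * x + suc (suc p) * u + a * y) + (suc e * u + suc p * v + a * z) ≡
                 (e * (x + u) + suc p * (u + v) + a * (y + z)) + 2 * u
    rearrange₁ = solve-∀

  rearrange : ∀ e p a x y z → e * x + 2 * (suc p * z) + a * y + 2 * z ≡ e * x + 2 * (suc (suc p) * z) + a * y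
  rearrange = solve-∀

  collect : ∀ p → e * V e p (suc a) + 2 * (p * V (suc e) (pred p) (suc a)) + a * V (suc e) p a + 2 * U (suc e) p (suc a) ≡
            e * V e p (suc a) + 2 * (suc p * U (suc e) p (suc a)) + a * V (suc e) p a
  collect zero    = rearrange′ e a (V e 0 (suc a)) (V (suc e) 0 a) (U (suc e) 0 (suc a))
    where
    rearrange′ : ∀ e a x y z → e * x + 0 + a * y + 2 * z ≡ e * x + 2 * (1 * z) + a * y
    rearrange′ = solve-∀
  collect (suc p) = rearrange e p a (V e (suc p) (suc a)) (V (suc e) (suc p) a) (V (suc e) p (suc a))

plusMinus : List Sign
plusMinus = Sign.+ ∷ Sign.- ∷ []

-- Each index that is not fixed carries either sign.

allSigns : Stat → Stat
allSigns f e p a = 2 ^ (e + a) * signFixed f e p a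

-- The powers of 2 balance: a new letter that is not fixed has two signs and usually raises e + a by
-- one; after a fixed point it raises e + a by two, and the second factor 2 is the one of
-- `signFixed-insertionStep`.
growth-allSigns : ∀ f e p a → growth plus (allSigns f) e p a ≡ allSigns (growth plusMinus f) e p a
growth-allSigns f e p a = sym (begin
  q * signFixed (growth plusMinus f) e p a
    ≡⟨ cong (q *_) (signFixed-cong (λ e p a → rearrange (f e (suc p) a) (f (suc e) p a) (insertionStep f e p a)) e p a) ⟩
  q * signFixed (λ e p a → f e (suc p) a + f (suc e) p a + 2 * insertionStep f e p a) e p a
    ≡⟨ cong (q *_) (signFixed-+ (λ e p a → f e (suc p) a + f (suc e) p a) (λ e p a → 2 * insertionStep f e p a) e p a) ⟩
  q * (U e (suc p) a + signFixed (λ e p a → 2 * insertionStep f e p a) e p a)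
    ≡⟨ cong (λ r → q * (U e (suc p) a + r)) (trans (signFixed-* 2 (insertionStep f) e p a) (cong (2 *_) (signFixed-insertionStep f e p a))) ⟩
  q * (U e (suc p) a + 2 * (e * U e p (suc a) + 2 * (p * U (suc e) (pred p) (suc a)) + a * U (suc e) p a))
    ≡⟨ distribute q e p a (U e (suc p) a) (U e p (suc a)) (U (suc e) (pred p) (suc a)) (U (suc e) p a) ⟩
  q * U e (suc p) a + (e * (2 * q * U e p (suc a)) + p * (2 * (2 * q) * U (suc e) (pred p) (suc a)) + a * (2 * q * U (suc e) p a)) + 0
    ≡⟨ cong (λ i → q * U e (suc p) a + (e * (2 ^ i * U e p (suc a)) + p * (2 * 2 ^ i * U (suc e) (pred p) (suc a)) + a * (2 * q * U (suc e) p a)) + 0)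
         (+-suc e a) ⟨
  growth plus (allSigns f) e p a ∎)
  where
  q : ℕ
  q = 2 ^ (e + a)

  U : Stat
  U = signFixed f

  rearrange : ∀ x y z → x + z + (y + z + 0) ≡ x + y + 2 * z
  rearrange = solve-∀

  distribute : ∀ q e p a x y z w → q * (x + 2 * (e * y + 2 * (p * z) + a * w)) ≡
    q * x + (e * (2 * q * y) + p * (2 * (2 * q) * z) + a * (2 * q * w)) + 0
  distribute = solve-∀

total-plusMinus : ∀ n f → total plusMinus n f ≡ total plus n (allSigns f)
total-plusMinus zero    f = begin
  total plusMinus 0 f       ≡⟨ total-zero plusMinus f ⟩
  f 0 0 0                   ≡⟨ *-identityˡ (f 0 0 0) ⟨
  1 * f 0 0 0               ≡⟨ total-zero plus (allSigns f) ⟨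
  total plus 0 (allSigns f) ∎
total-plusMinus (suc n) f = begin
  total plusMinus (suc n) f                  ≡⟨ total-suc plusMinus n f ⟩
  total plusMinus n (growth plusMinus f)     ≡⟨ total-plusMinus n (growth plusMinus f) ⟩
  total plus n (allSigns (growth plusMinus f)) ≡⟨ total-cong plus n (growth-allSigns f) ⟨
  total plus n (growth plus (allSigns f))    ≡⟨ total-suc plus n (allSigns f) ⟨
  total plus (suc n) (allSigns f)            ∎

-- The three counts add up to n, so the power of c is constant. On generating functions this is the
-- substitution of c t for t.
tally-homogeneous : ∀ c (k : Fin n → Kind) f → tally k (λ e p a → c ^ (e + p + a) * f e p a) ≡ c ^ n * tally k f
tally-homogeneous {zero}  c k f = refl
tally-homogeneous {suc n} c k f = begin
  tally (k ∘ suc) (bump (k zero) (λ e p a → c ^ (e + p + a) * f e p a))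
    ≡⟨ tally-cong (k ∘ suc) (bump-^ (k zero)) ⟩
  tally (k ∘ suc) (λ e p a → c ^ (e + p + a) * (c * bump (k zero) f e p a))
    ≡⟨ tally-homogeneous c (k ∘ suc) (λ e p a → c * bump (k zero) f e p a) ⟩
  c ^ n * tally (k ∘ suc) (λ e p a → c * bump (k zero) f e p a)
    ≡⟨ cong (c ^ n *_) (tally-* (k ∘ suc) c (bump (k zero) f)) ⟩
  c ^ n * (c * tally (k ∘ suc) (bump (k zero) f))
    ≡⟨ assoc (c ^ n) c _ ⟩
  c * c ^ n * tally (k ∘ suc) (bump (k zero) f) ∎
  where
  assoc : ∀ q c x → q * (c * x) ≡ c * q * x
  assoc = solve-∀

  bump-^ : ∀ k e p a → bump k (λ e p a → c ^ (e + p + a) * f e p a) e p a ≡ c ^ (e + p + a) * (c * bump k f e p a)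
  bump-^ exceeds e p a = sym (assoc (c ^ (e + p + a)) c _)
  bump-^ fixed⁺  e p a = trans (cong (λ i → c ^ (i + a) * f e (suc p) a) (+-suc e p)) (sym (assoc (c ^ (e + p + a)) c _))
  bump-^ falls   e p a = trans (cong (λ i → c ^ i * f e p (suc a)) (+-suc (e + p) a)) (sym (assoc (c ^ (e + p + a)) c _))

total-homogeneous : ∀ ss n c f → total ss n (λ e p a → c ^ (e + p + a) * f e p a) ≡ c ^ n * total ss n f
total-homogeneous ss n c f = trans
  (sumOver-cong (vectors ss n) λ ε → trans
    (sumOver-cong (permutations n) λ u → tally-homogeneous c (kind (ε , u)) f)
    (sumOver-* (c ^ n) (permutations n) _))
  (sumOver-* (c ^ n) (vectors ss n) _)

-- The generating functions of d, dB and A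

module _ (x : ℕ) where

  -- The factor 0 ^ p selects the derangements.

  derangementStat : Stat
  derangementStat e p a = x ^ e * 0 ^ p

  derangementSeq derangementSeqB eulerianSeq : Seq
  derangementSeq  n = total plus n derangementStat
  derangementSeqB n = total plusMinus n derangementStat
  eulerianSeq zero    = 0
  eulerianSeq (suc n) = descentTotal n (λ e p a → x ^ e)

  -- Of all choices of signs only the one that makes every fixed point negative survives the factor
  -- 0 ^ p.
  signFixed-derangementStat : ∀ e p a → signFixed derangementStat e p a ≡ x ^ (e + p)
  signFixed-derangementStat e zero    a = trans (*-identityʳ (x ^ e)) (cong (x ^_) (sym (+-identityʳ e)))
  signFixed-derangementStat e (suc p) a = begin
    signFixed (λ e p a → x ^ e * 0 ^ suc p + x ^ suc e * 0 ^ p) e p a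
      ≡⟨ signFixed-cong (λ e p a → rearrange x (x ^ e) (0 ^ p)) e p a ⟩
    signFixed (λ e p a → x * derangementStat e p a) e p a
      ≡⟨ signFixed-* x derangementStat e p a ⟩
    x * signFixed derangementStat e p a
      ≡⟨ cong (x *_) (signFixed-derangementStat e p a) ⟩
    x ^ suc (e + p)
      ≡⟨ cong (x ^_) (+-suc e p) ⟨
    x ^ (e + suc p) ∎
    where
    rearrange : ∀ x y z → y * 0 + x * y * z ≡ x * (y * z)
    rearrange = solve-∀

  -- Only the choice of all fixed points survives, with weight y each. So y = 1 counts permutations
  -- by excedances and y = x counts them by weak excedances.
  shiftFixed-derangementStat : ∀ y e p a → shiftFixed y derangementStat e p a ≡ x ^ e * y ^ p
  shiftFixed-derangementStat y e p a =
    trans (binomialShift-* y (x ^ e) (0 ^_) p) (cong (x ^ e *_) (binomialShift-0^ y p))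

  excedances-eulerian : const 1 ⊞ eulerianSeq ≗ (1 ^_) ⋆ derangementSeq
  excedances-eulerian n = begin
    (const 1 ⊞ eulerianSeq) n                  ≡⟨ unfold n ⟩
    total plus n (λ e p a → x ^ e)             ≡⟨ total-cong plus n (λ e p a → sym (trans (shiftFixed-derangementStat 1 e p a)
                                                     (trans (cong (x ^ e *_) (^-zeroˡ p)) (*-identityʳ (x ^ e))))) ⟩
    total plus n (shiftFixed 1 derangementStat) ≡⟨ total-shiftFixed 1 derangementStat n ⟩
    ((1 ^_) ⋆ derangementSeq) n                ∎
    where
    unfold : ∀ n → (const 1 ⊞ eulerianSeq) n ≡ total plus n (λ e p a → x ^ e)
    unfold zero    = refl
    unfold (suc n) = sym (excedances-descents n (λ e _ → x ^ e))

  weakExcedances-eulerian : const 1 ⊞ const x ⋆ eulerianSeq ≗ (x ^_) ⋆ derangementSeq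
  weakExcedances-eulerian n = begin
    (const 1 ⊞ const x ⋆ eulerianSeq) n          ≡⟨ cong (const 1 n +_) (const-⋆ x eulerianSeq n) ⟩
    const 1 n + x * eulerianSeq n                ≡⟨ unfold n ⟩
    total plus n (λ e p a → x ^ (e + p))         ≡⟨ total-cong plus n (λ e p a → sym (trans (shiftFixed-derangementStat x e p a)
                                                     (sym (^-distribˡ-+-* x e p)))) ⟩
    total plus n (shiftFixed x derangementStat)  ≡⟨ total-shiftFixed x derangementStat n ⟩
    ((x ^_) ⋆ derangementSeq) n                  ∎
    where
    unfold : ∀ n → const 1 n + x * eulerianSeq n ≡ total plus n (λ e p a → x ^ (e + p))
    unfold zero    = cong suc (*-zeroʳ x)
    unfold (suc n) = begin
      x * descentTotal n (λ e p a → x ^ e)       ≡⟨ descentTotal-* ⟨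
      descentTotal n (λ e p a → x * x ^ e)       ≡⟨ weakExcedances-descents n (λ w _ → x ^ w) ⟨
      total plus (suc n) (λ e p a → x ^ (e + p)) ∎
      where
      descentTotal-* : descentTotal n (λ e p a → x * x ^ e) ≡ x * descentTotal n (λ e p a → x ^ e)
      descentTotal-* = trans (sumOver-cong (permutations (suc n)) λ u → tally-* (descentKind u) x (λ e p a → x ^ e))
                             (sumOver-* x (permutations (suc n)) _)

  -- In `allSigns` the power of 2 omits the fixed points, but homogeneity needs all letters. The
  -- factor 0 ^ p reconciles the two: `doubled` is nonzero at most when p = 0, and there the
  -- exponents agree.
  derangementSeqB-⋆ : derangementSeqB ≗ (x ^_) ⋆ scale 2 derangementSeq
  derangementSeqB-⋆ n = begin
    total plusMinus n derangementStat
      ≡⟨ total-plusMinus n derangementStat ⟩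
    total plus n (allSigns derangementStat)
      ≡⟨ total-cong plus n merge ⟩
    total plus n (shiftFixed x doubled)
      ≡⟨ total-shiftFixed x doubled n ⟩
    ((x ^_) ⋆ (λ m → total plus m doubled)) n
      ≡⟨ ⋆-cong {x ^_} (λ _ → refl) (λ m → total-homogeneous plus m 2 derangementStat) n ⟩
    ((x ^_) ⋆ scale 2 derangementSeq) n ∎
    where
    doubled : Stat
    doubled e p a = 2 ^ (e + p + a) * derangementStat e p a

    doubled≡ : ∀ e p a → doubled e p a ≡ 2 ^ (e + a) * x ^ e * 0 ^ p
    doubled≡ e zero    a = trans (cong (λ i → 2 ^ (i + a) * (x ^ e * 1)) (+-identityʳ e)) (sym (*-assoc (2 ^ (e + a)) (x ^ e) 1))
    doubled≡ e (suc p) a = trans (cong (2 ^ (e + suc p + a) *_) (*-zeroʳ (x ^ e)))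
      (trans (*-zeroʳ (2 ^ (e + suc p + a))) (sym (*-zeroʳ (2 ^ (e + a) * x ^ e))))

    merge : ∀ e p a → allSigns derangementStat e p a ≡ shiftFixed x doubled e p a
    merge e p a = begin
      2 ^ (e + a) * signFixed derangementStat e p a      ≡⟨ cong (2 ^ (e + a) *_) (signFixed-derangementStat e p a) ⟩
      2 ^ (e + a) * x ^ (e + p)                          ≡⟨ cong (2 ^ (e + a) *_) (^-distribˡ-+-* x e p) ⟩
      2 ^ (e + a) * (x ^ e * x ^ p)                      ≡⟨ *-assoc (2 ^ (e + a)) (x ^ e) _ ⟨
      2 ^ (e + a) * x ^ e * x ^ p                        ≡⟨ cong (2 ^ (e + a) * x ^ e *_) (binomialShift-0^ x p) ⟨
      2 ^ (e + a) * x ^ e * binomialShift x (0 ^_) p     ≡⟨ binomialShift-* x (2 ^ (e + a) * x ^ e) (0 ^_) p ⟨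
      binomialShift x (λ p → 2 ^ (e + a) * x ^ e * 0 ^ p) p ≡⟨ binomialShift-cong x (λ p → doubled≡ e p a) p ⟨
      shiftFixed x doubled e p a ∎

-- Values of the polynomials of the theorem

isExceeds : Kind → Bool
isExceeds exceeds = true
isExceeds fixed⁺  = false
isExceeds falls   = false

-- A general h lets the induction pass to the tail of the list of all indices.
tally-count : {P : I → Set} (P? : Decidable P) (h : Fin n → I) (c : Fin n → Kind) →
  (∀ i → isExceeds (c i) ≡ does (P? (h i))) →
  (g : ℕ → ℕ) → tally c (λ e _ _ → g e) ≡ g (count P? (tabulate h))
tally-count {n = zero}  P? h c eq g = refl
tally-count {n = suc n} P? h c eq g with c zero | does (P? (h zero)) | eq zero
... | exceeds | true  | _ = tally-count P? (h ∘ suc) (c ∘ suc) (eq ∘ suc) (g ∘ suc)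
... | fixed⁺  | false | _ = tally-count P? (h ∘ suc) (c ∘ suc) (eq ∘ suc) g
... | falls   | false | _ = tally-count P? (h ∘ suc) (c ∘ suc) (eq ∘ suc) g

tally-unfixed : (c : Fin n → Kind) → (∀ i → c i ≢ fixed⁺) → (f : Stat) → tally c f ≡ tally c (λ e _ a → f e 0 a)
tally-unfixed {zero}  c c≢ f = refl
tally-unfixed {suc n} c c≢ f with c zero | c≢ zero
... | exceeds | _  = tally-unfixed (c ∘ suc) (c≢ ∘ suc) (bump exceeds f)
... | fixed⁺  | c≢ = contradiction refl c≢
... | falls   | _  = tally-unfixed (c ∘ suc) (c≢ ∘ suc) (bump falls f)

tally-0 : (c : Fin n → Kind) → tally c (λ _ _ _ → 0) ≡ 0
tally-0 c = tally-* c 0 (λ _ _ _ → 0)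

tally-fixed : (c : Fin (suc n) → Kind) {i : Fin (suc n)} → c i ≡ fixed⁺ → (f : Stat) → (∀ e p a → f e (suc p) a ≡ 0) → tally c f ≡ 0
tally-fixed c {i} ci≡ f f≡0 = begin
  tally c f                                ≡⟨ tally-remove c i f ⟩
  tally (c ∘ punchIn i) (bump (c i) f)     ≡⟨ cong (λ k → tally (c ∘ punchIn i) (bump k f)) ci≡ ⟩
  tally (c ∘ punchIn i) (bump fixed⁺ f)    ≡⟨ tally-cong (c ∘ punchIn i) f≡0 ⟩
  tally (c ∘ punchIn i) (λ _ _ _ → 0)      ≡⟨ tally-0 (c ∘ punchIn i) ⟩
  0 ∎

isExceeds-kindOf : ∀ a b → isExceeds (kindOf a b) ≡ does (excedance? a b)
isExceeds-kindOf a b with does (excedance? a b)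
... | true = refl
... | false with does (positiveFixed? a b)
...   | true  = refl
...   | false = refl

kindOf≡fixed⁺ : ∀ a b → kindOf a b ≡ fixed⁺ → PositiveFixed a b
kindOf≡fixed⁺ a b eq = decidable-stable (positiveFixed? a b) λ ¬fix → not-fixed ¬fix eq
  where
  not-fixed : ¬ PositiveFixed a b → kindOf a b ≢ fixed⁺
  not-fixed ¬fix rewrite dec-false (positiveFixed? a b) ¬fix with does (excedance? a b)
  ... | true  = λ ()
  ... | false = λ ()

tally-derangementStat : ∀ x (w : SignedPermutation n) →
  tally (kind w) (derangementStat x) ≡ (if does (isBDerangement? w) then x ^ excB w else 0)
tally-derangementStat {n} x w = go (isBDerangement? w)
  where
  -- The size is generalised so that matching can turn it into a successor, as `tally-fixed`
  -- requires.
  someFixed : ∀ {n} (w : SignedPermutation n) → ∃[ i ] PositiveFixed (element w i) (image w i) → tally (kind w) (derangementStat x) ≡ 0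
  someFixed {suc _} w (i , fix) = tally-fixed (kind w) {i} (kindOf-fixed⁺ fix) (derangementStat x) (λ e p a → *-zeroʳ (x ^ e))

  value : Bool → ℕ
  value b = if b then x ^ excB w else 0

  go : Dec (IsBDerangement w) → tally (kind w) (derangementStat x) ≡ value (does (isBDerangement? w))
  go (yes der) = begin
    tally (kind w) (derangementStat x)
      ≡⟨ tally-unfixed (kind w) (λ i fix → der (i , kindOf≡fixed⁺ (element w i) (image w i) fix)) (derangementStat x) ⟩
    tally (kind w) (λ e _ _ → x ^ e * 1)
      ≡⟨ tally-count (isBExcedance? w) (λ i → i) (kind w) (λ i → isExceeds-kindOf (element w i) (image w i)) (λ e → x ^ e * 1) ⟩
    x ^ excB w * 1
      ≡⟨ *-identityʳ _ ⟩
    x ^ excB w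
      ≡⟨ cong value (dec-true (isBDerangement? w) der) ⟨
    value (does (isBDerangement? w)) ∎
  go (no ¬der) = trans
    (someFixed w (decidable-stable (Fin.any? λ i → positiveFixed? (element w i) (image w i)) ¬der))
    (sym (cong value (dec-false (isBDerangement? w) ¬der)))

eval-∑-filter : ∀ x {P : I → Set} (P? : Decidable P) (is : List I) (f : I → ℕ) →
  eval x (∑ (filter P? is) (x^ ∘ f)) ≡ Σ[ i ∈ is ] (if does (P? i) then x ^ f i else 0)
eval-∑-filter x P? is f = begin
  eval x (∑ (filter P? is) (x^ ∘ f))                 ≡⟨ eval-∑ x (filter P? is) (x^ ∘ f) ⟩
  sumOver (filter P? is) (eval x ∘ x^ ∘ f)           ≡⟨ sumOver-cong (filter P? is) (λ i → eval-x^ x (f i)) ⟩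
  sumOver (filter P? is) (λ i → x ^ f i)             ≡⟨ sumOver-filter P? is (λ i → x ^ f i) ⟩
  (Σ[ i ∈ is ] (if does (P? i) then x ^ f i else 0)) ∎

eval-dB : ∀ x n → eval x (dB n) ≡ derangementSeqB x n
eval-dB x n = begin
  eval x (dB n)
    ≡⟨ eval-∑-filter x isBDerangement? (signedPermutations n) excB ⟩
  (Σ[ w ∈ signedPermutations n ] (if does (isBDerangement? w) then x ^ excB w else 0))
    ≡⟨ sumOver-cong (signedPermutations n) (λ w → sym (tally-derangementStat x w)) ⟩
  (Σ[ w ∈ signedPermutations n ] tally (kind w) (derangementStat x))
    ≡⟨ sumOver-cartesianProductWith _,_ (vectors plusMinus n) (permutations n) _ ⟩
  derangementSeqB x n ∎

sumOver-vectors-singleton : (i : I) (n : ℕ) (f : Vec I n → ℕ) → sumOver (vectors (i ∷ []) n) f ≡ f (Vec.replicate n i)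
sumOver-vectors-singleton i zero    f = +-identityʳ (f [])
sumOver-vectors-singleton i (suc n) f = trans
  (sumOver-cartesianProductWith _∷_ (i ∷ []) (vectors (i ∷ []) n) f)
  (trans (+-identityʳ _) (sumOver-vectors-singleton i n (f ∘ (i ∷_))))

count-⇔ : {P Q : I → Set} (P? : Decidable P) (Q? : Decidable Q) → (∀ i → P i ⇔ Q i) →
          (v : Vec I n) → count P? v ≡ count Q? v
count-⇔ P? Q? P⇔Q []      = refl
count-⇔ P? Q? P⇔Q (i ∷ v) = cong₂ (λ b k → (if b then suc else λ k → k) k)
  (does-⇔ (P⇔Q i) (P? i) (Q? i)) (count-⇔ P? Q? P⇔Q v)

module _ (u : Vec (Fin n) n) where

  private
    w : SignedPermutation n
    w = Vec.replicate n Sign.+ , u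

  positive : ∀ i → element w i ≡ ℤ.+ suc (toℕ i)
  positive i = cong (_◃ suc (toℕ i)) (Vec.lookup-replicate i Sign.+)

  exc≡excB : exc u ≡ excB w
  exc≡excB = count-⇔ (λ i → i Fin.<? lookup u i) (isBExcedance? w) (λ i → mk⇔ (to i) (from i)) (Vec.allFin n)
    where
    to : ∀ i → i Fin.< lookup u i → IsBExcedance w i
    to i i<ui = inj₁ (subst₂ ℤ._<_ (sym (positive i)) (sym (positive (lookup u i))) (ℤ.+<+ (s<s i<ui)))

    from : ∀ i → IsBExcedance w i → i Fin.< lookup u i
    from i (inj₁ <) = s<s⁻¹ (ℤ.drop‿+<+ (subst₂ ℤ._<_ (positive i) (positive (lookup u i)) <))
    from i (inj₂ (<0 , _)) with () ← ℤ.drop‿+<+ (subst (ℤ._< 0ℤ) (positive i) <0)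

  isDerangement≡isBDerangement : does (isDerangement? u) ≡ does (isBDerangement? w)
  isDerangement≡isBDerangement = does-⇔ (mk⇔
      (λ der (i , _ , eq) → der (i , Fin.toℕ-injective (suc-injective (ℤ.+-injective
        (trans (sym (positive (lookup u i))) (trans eq (positive i)))))))
      (λ der (i , eq) → der (i , subst (0ℤ ℤ.<_) (sym (positive i)) (ℤ.+<+ z<s) , cong (element w) eq)))
    (isDerangement? u) (isBDerangement? w)

-- A permutation is treated as the signed permutation with all signs positive, so the evaluation for
-- signed permutations is reused.
eval-d : ∀ x n → eval x (d n) ≡ derangementSeq x n
eval-d x n = begin
  eval x (d n)
    ≡⟨ eval-∑-filter x isDerangement? (permutations n) exc ⟩
  (Σ[ u ∈ permutations n ] (if does (isDerangement? u) then x ^ exc u else 0))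
    ≡⟨ sumOver-cong (permutations n) (λ u → trans
         (cong₂ (λ b e → if b then x ^ e else 0) (isDerangement≡isBDerangement u) (exc≡excB u))
         (sym (tally-derangementStat x (Vec.replicate n Sign.+ , u)))) ⟩
  (Σ[ u ∈ permutations n ] tally (kind (Vec.replicate n Sign.+ , u)) (derangementStat x))
    ≡⟨ sumOver-vectors-singleton Sign.+ n _ ⟨
  derangementSeq x n ∎

eval-A : ∀ x n → eval x (A n) ≡ eulerianSeq x n
eval-A x zero    = refl
eval-A x (suc n) = begin
  eval x (∑ (permutations (suc n)) (x^ ∘ des))
    ≡⟨ eval-∑ x (permutations (suc n)) (x^ ∘ des) ⟩
  (Σ[ u ∈ permutations (suc n) ] eval x (x^ (des u)))
    ≡⟨ sumOver-cong (permutations (suc n)) (λ u → trans (eval-x^ x (des u))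
         (sym (tally-count (λ i → lookup u (suc i) Fin.<? lookup u (inject₁ i)) (λ i → i) (descentKind u)
           (λ i → isExceeds-stepKind (lookup u (inject₁ i)) (lookup u (suc i))) (x ^_)))) ⟩
  eulerianSeq x (suc n) ∎
  where
  isExceeds-stepKind : (a b : Fin (suc n)) → isExceeds (stepKind a b) ≡ does (b Fin.<? a)
  isExceeds-stepKind a b with does (b Fin.<? a)
  ... | true  = refl
  ... | false = refl

eval-∏ : ∀ x {k} (p : ℕ → ℕ[x]) (rs : Vec ℕ k) → eval x (∏ (Vec.map p rs)) ≡ product (Vec.map (eval x ∘ p) rs)
eval-∏ x p []       = eval-1ₚ x
eval-∏ x p (r ∷ rs) = trans (eval-⊗ x (p r) (∏ (Vec.map p rs))) (cong (eval x (p r) *_) (eval-∏ x p rs))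

product-cong : ∀ {k f g} → f ≗ g → (rs : Vec ℕ k) → product (Vec.map f rs) ≡ product (Vec.map g rs)
product-cong f≗g rs = cong product (Vec.map-cong f≗g rs)

-- The power of x depends on k alone. What remains after pulling it out is a multinomial sum with
-- bound n + 1, which is coefficient n of δ αᵏ.
eval-summands : ∀ x n k → eval x (∑ (sequences n k) (summand n k)) ≡ seriesTerm x (eulerianSeq x) (derangementSeq x) k n
eval-summands x n k = begin
  eval x (∑ (sequences n k) (summand n k))
    ≡⟨ eval-∑ x (sequences n k) (summand n k) ⟩
  sumOver (sequences n k) (eval x ∘ summand n k)
    ≡⟨ sumOver-filter (λ r → Vec.sum r ≟ n) (vectors (upTo (suc n)) (suc k)) _ ⟩
  (Σ[ r ∈ vectors (upTo (suc n)) (suc k) ] (if does (Vec.sum r ≟ n) then eval x (summand n k r) else 0))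
    ≡⟨ sumOver-cong (vectors (upTo (suc n)) (suc k)) each ⟩
  (Σ[ r ∈ vectors (upTo (suc n)) (suc k) ] c * (if does (Vec.sum r ≟ n) then multinomial n r * (δ (Vec.head r) * h (Vec.tail r)) else 0))
    ≡⟨ sumOver-* c (vectors (upTo (suc n)) (suc k)) _ ⟩
  c * multinomialSum (suc n) (suc k) (λ r → δ (Vec.head r) * h (Vec.tail r)) n
    ≡⟨ cong (c *_) (multinomialSum-∷ k δ h (n<1+n n)) ⟩
  c * (δ ⋆ multinomialSum (suc n) k h) n
    ≡⟨ cong (c *_) (⋆-cong≤ {n} δ (λ m≤n → multinomialSum-⋆^ k α (s≤s m≤n))) ⟩
  c * (δ ⋆ α ⋆^ k) n ∎
  where
  α δ : Seq
  α = eulerianSeq x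
  δ = derangementSeq x

  h : Vec ℕ k → ℕ
  h rs = product (Vec.map α rs)

  c : ℕ
  c = x ^ ⌊ k + 1 /2⌋

  rearrange : ∀ a b c d → a * (b * c * d) ≡ b * (a * (c * d))
  rearrange = solve-∀

  eval-summand : ∀ r → eval x (summand n k r) ≡ c * (multinomial n r * (δ (Vec.head r) * h (Vec.tail r)))
  eval-summand r@(r₀ ∷ rs) = begin
    eval x (multinomial n r · (x^ ⌊ k + 1 /2⌋ ⊗ d r₀ ⊗ ∏ (Vec.map A rs)))
      ≡⟨ eval-· x (multinomial n r) (x^ ⌊ k + 1 /2⌋ ⊗ d r₀ ⊗ ∏ (Vec.map A rs)) ⟩
    multinomial n r * eval x (x^ ⌊ k + 1 /2⌋ ⊗ d r₀ ⊗ ∏ (Vec.map A rs))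
      ≡⟨ cong (multinomial n r *_) (trans (eval-⊗ x (x^ ⌊ k + 1 /2⌋ ⊗ d r₀) _) (cong₂ _*_
           (trans (eval-⊗ x (x^ ⌊ k + 1 /2⌋) (d r₀)) (cong₂ _*_ (eval-x^ x ⌊ k + 1 /2⌋) (eval-d x r₀)))
           (trans (eval-∏ x A rs) (product-cong (eval-A x) rs)))) ⟩
    multinomial n r * (c * δ r₀ * h rs)
      ≡⟨ rearrange (multinomial n r) c (δ r₀) (h rs) ⟩
    c * (multinomial n r * (δ r₀ * h rs)) ∎

  each : ∀ r → (if does (Vec.sum r ≟ n) then eval x (summand n k r) else 0) ≡
               c * (if does (Vec.sum r ≟ n) then multinomial n r * (δ (Vec.head r) * h (Vec.tail r)) else 0)
  each r with does (Vec.sum r ≟ n)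
  ... | true  = eval-summand r
  ... | false = sym (*-zeroʳ c)

theorem1p1 : (n : ℕ) → HasSum (λ k → ∑ (sequences n k) (summand n k)) (dB n)
-- The bound is that of `series`: n + 1 rounds with two terms each. The test value 2 + y is 1 +
-- `suc y`, and `suc y` is the nonzero number cancelled in `functionalEquation`.
theorem1p1 n = suc n * 2 , vanishing , ≈-from-eval (∑ (upTo (suc n * 2)) terms) (dB n) (λ y → total≡ (suc y))
  where
  terms : ℕ → ℕ[x]
  terms k = ∑ (sequences n k) (summand n k)

  vanishing : ∀ k → suc n * 2 ≤ k → terms k ≈ 0ₚ
  vanishing k N≤k = ≈-from-eval (terms k) 0ₚ λ y → trans (eval-summands (2 + y) n k)
    (seriesTerm-vanishes (2 + y) (eulerianSeq (2 + y)) (derangementSeq (2 + y)) refl {k} {n} (≤-trans (m≤m*n (suc n) 2) N≤k))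

  total≡ : ∀ y .{{_ : NonZero y}} → eval (suc y) (∑ (upTo (suc n * 2)) terms) ≡ eval (suc y) (dB n)
  total≡ y = begin
    eval x (∑ (upTo (suc n * 2)) terms)
      ≡⟨ eval-∑ x (upTo (suc n * 2)) terms ⟩
    (Σ[ k ∈ upTo (suc n * 2) ] eval x (terms k))
      ≡⟨ sumOver-cong (upTo (suc n * 2)) (λ k → eval-summands x n k) ⟩
    (Σ[ k ∈ upTo (suc n * 2) ] seriesTerm x (eulerianSeq x) (derangementSeq x) k n)
      ≡⟨ series x (eulerianSeq x) (derangementSeq x)
           (functionalEquation y (excedances-eulerian x) (weakExcedances-eulerian x) (derangementSeqB-⋆ x)) refl n ⟨
    derangementSeqB x n
      ≡⟨ eval-dB x n ⟨
    eval x (dB n) ∎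
    where x = suc y
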